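{- Let $n\ge 1$ and let $w$ be a Kreweras word of length $3n$. Then $\mathrm{pro}^{3n}(w)$ is the word obtained from $w$ by replacing every $\mathsf{B}$ by $\mathsf{C}$ and every $\mathsf{C}$ by $\mathsf{B}$. In particular, $\mathrm{pro}^{6n}(w)=w$.
   Context: A Kreweras word of length $3n$ is a word $w=(w_1,\dots,w_{3n})$ in the letters $\mathsf{A},\mathsf{B},\mathsf{C}$ containing exactly $n$ copies of each letter, such that every prefix $(w_1,\dots,w_k)$ contains at least as many $\mathsf{A}$'s as $\mathsf{B}$'s and at least as many $\mathsf{A}$'s as $\mathsf{C}$'s. For such $w$, let $\iota(w)$ be the smallest index $\iota\ge 1$ such that the prefix $(w_1,\dots,w_\iota)$ contains the same number of $\mathsf{A}$'s as $\mathsf{B}$'s or the same number of $\mathsf{A}$'s as $\mathsf{C}$'s. The promotion of $w$ is $\mathrm{pro}(w)=(w_2,w_3,\dots,w_{\iota(w)-1},\mathsf{A},w_{\iota(w)+1},\dots,w_{3n},w_{\iota(w)})$; it is again a Kreweras word, and $\mathrm{pro}$ is a bijection on the set of Kreweras words of length $3n$. $\mathrm{pro}^k$ denotes the $k$-fold iterate. -}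

module Defs where

open import Data.Nat using (ℕ; zero; suc; _≤_; _≡ᵇ_)
open import Data.Bool using (Bool; true; false; _∨_; if_then_else_)
open import Data.List using (List; []; _∷_; _++_; take)
open import Data.Maybe using (Maybe; just; nothing)
open import Data.Product using (_×_; _,_)
open import Relation.Binary.PropositionalEquality using (_≡_)
open import Function using (_∘_)

data Letter : Set where
  A B C : Letter

Word : Set
Word = List Letter

count : Letter → Word → ℕ
count x [] = 0
count A (A ∷ w) = suc (count A w)
count A (B ∷ w) = count A w
count A (C ∷ w) = count A w
count B (B ∷ w) = suc (count B w)
count B (A ∷ w) = count B w
count B (C ∷ w) = count B w
count C (C ∷ w) = suc (count C w)
count C (A ∷ w) = count C w
count C (B ∷ w) = count C w

record IsKreweras (n : ℕ) (w : Word) : Set where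
  field
    countA : count A w ≡ n
    countB : count B w ≡ n
    countC : count C w ≡ n
    prefixB : ∀ k → count B (take k w) ≤ count A (take k w)
    prefixC : ∀ k → count C (take k w) ≤ count A (take k w)

-- Splitting at ι.  split a b c u: a, b, c are the numbers of A, B, C in the
-- prefix already read; u is the remaining suffix.  Finds the first letter x
-- of u after which the prefix has #A = #B or #A = #C, and returns
-- (letters of u before x , x , letters of u after x).
split : ℕ → ℕ → ℕ → Word → Maybe (Word × Letter × Word)
split a b c [] = nothing
split a b c (x ∷ u) = go x (upd x)
  where
    upd : Letter → ℕ × ℕ × ℕ
    upd A = suc a , b , c
    upd B = a , suc b , c
    upd C = a , b , suc c
    go : Letter → ℕ × ℕ × ℕ → Maybe (Word × Letter × Word)
    go x (a' , b' , c') =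
      if (a' ≡ᵇ b') ∨ (a' ≡ᵇ c')
        then just ([] , x , u)
        else rest (split a' b' c' u)
      where
        rest : Maybe (Word × Letter × Word) → Maybe (Word × Letter × Word)
        rest nothing = nothing
        rest (just (v , y , t)) = just (x ∷ v , y , t)

-- Promotion: pro(w) = (w₂ … w_{ι-1}, A, w_{ι+1} … w_{3n}, w_ι).
-- For a Kreweras word w₁ = A, so ι ≥ 2 and the scan starts after w₁
-- (prefix counts 1,0,0).  On words where no ι exists (never the case for
-- Kreweras words) we leave the word unchanged.
pro : Word → Word
pro [] = []
pro (x ∷ u) with split 1 0 0 u
... | nothing = x ∷ u
... | just (v , y , t) = v ++ (A ∷ t) ++ (y ∷ [])

iter : ℕ → (Word → Word) → Word → Word
iter zero f w = w
iter (suc k) f w = f (iter k f w)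

swapBC : Letter → Letter
swapBC A = A
swapBC B = C
swapBC C = B

{-# OPTIONS --safe #-}
-- Write h(t) and k(t) for #A − #B and #A − #C on the prefix of length t (or the
-- other way round).  Follow a letter c (B or C) at position j.  At some promotion
-- step it is w_ι: it becomes an A at ι − 1 and a copy of c lands at the end.  The
-- level inequalities "Backward" tie that copy (position i) to the A (position j < i)
-- and survive promotion, both positions dropping by one, until the A comes first.
-- It is then closed by the letter c̄ other than c, which lands at the end.
-- The inequalities "Forward" tie c (position i) to c̄ (position j > i); they too
-- survive, until the c at i becomes an A, when they turn into "Opening", which keeps
-- the c̄ at j from being w_ι as long as the A at i is not first.  The index i needs
-- a full turn to come back to the first place, so after 3n steps the original
-- position j carries c̄.  So every B has become C and vice versa; since the
-- number of A's is unchanged, every A is back at its place.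
--
-- "Forward" and "Backward" say that the trip through the bump diagram starting at i
-- ends at j, rewritten in terms of levels: arcs covering a position become drops of
-- a level below its value there.
module Submission where

open import Defs
open import Data.Bool as Bool using (Bool; true; false; not)
open import Data.Bool.Properties using (not-involutive; ¬-not)
open import Data.Empty using (⊥; ⊥-elim)
open import Data.List using ([]; _∷_; _++_; drop; head; length; map; take)
open import Data.List.Properties using (take-all; ++-assoc; length-++)
open import Data.Maybe using (just)
open import Data.Maybe.Properties using (just-injective)
open import Data.Nat
open import Data.Nat.Properties
open import Data.Nat.Tactic.RingSolver using (solve)
open import Algebra.Properties.CommutativeSemigroup +-commutativeSemigroup using (interchange; x∙yz≈y∙xz)
open import Data.Product using (_×_; _,_; proj₁; proj₂; ∃-syntax)
open import Data.Sum using (_⊎_; inj₁; inj₂)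
open import Function using (_∘_)
open import Relation.Binary.Definitions using (tri<; tri≈; tri>)
open import Relation.Binary.PropositionalEquality
open import Relation.Nullary using (yes; no; contradiction)

-- Cancelling uniform shifts in inequalities

shift-≤ : ∀ {α α′ x x′ y y′} → α + x ≡ α′ + x′ → α + y ≡ α′ + y′ → x ≤ y → x′ ≤ y′
shift-≤ {α} {α′} ex ey x≤y = +-cancelˡ-≤ α′ _ _ (subst₂ _≤_ ex ey (+-monoʳ-≤ α x≤y))

shift-< : ∀ {α α′ x x′ y y′} → α + x ≡ α′ + x′ → α + y ≡ α′ + y′ → x < y → x′ < y′
shift-< {α} {α′} ex ey x<y = +-cancelˡ-< α′ _ _ (subst₂ _<_ ex ey (+-monoʳ-< α x<y))

shift-+ : ∀ {α α′ β β′ x x′ y y′} → α + x ≡ α′ + x′ → β + y ≡ β′ + y′ →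
          (α + β) + (x + y) ≡ (α′ + β′) + (x′ + y′)
shift-+ {α} {α′} {β} {β′} {x} {x′} {y} {y′} ex ey =
  trans (interchange α β x y) (trans (cong₂ _+_ ex ey) (sym (interchange α′ β′ x′ y′)))

-- The level inequalities carried along by promotion

Within : ℕ → ℕ → (ℕ → Set) → Set
Within a b P = ∃[ s ] (a ≤ s × s ≤ b × P s)

pred-within : ∀ {a b P} → Within (suc a) (suc b) P → Within a b (P ∘ suc)
pred-within (suc s , s≤s a≤s , s≤s s≤b , q) = s , a≤s , s≤b , q

-- Terms are moved across to avoid subtraction. `right`: a drop of `k` at `t`, measured from
-- `suc i`, is matched by a drop of `h` at least as deep, no later than `t`. `floor`: no drop of `h`
-- up to `j` exceeds the drop of `k` at `j`. `left` is `right` read leftwards from `i` with `h` and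
-- `k` exchanged, and is waived where `k` goes below `k j`. With one `h` and one `k` on each side, a
-- uniform change of levels cancels.
record Forward (h k : ℕ → ℕ) (i j : ℕ) : Set where
  field
    right : ∀ {t} → i < t → t ≤ j →
            Within (suc i) t λ s → h s + k (suc i) ≤ h (suc i) + k t
    floor : ∀ {t} → i < t → t ≤ j → h (suc i) + k j ≤ h t + k (suc i)
    left  : ∀ {t} → t ≤ i →
            Within t i λ s → k s < k j ⊎ h i + k s ≤ h t + k i

-- `left` is the condition of `Forward` without the escape clause. By `floor`, seen from `i`, the
-- drop of `k` anywhere back to `j` stays smaller than the drop of `h` at `j`. `right` is waived
-- once `h` has come down to `h j`.
record Backward (N : ℕ) (h k : ℕ → ℕ) (i j : ℕ) : Set where
  field
    left  : ∀ {t} → j < t → t ≤ i → Within t i λ s → h i + k s ≤ h t + k i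
    floor : ∀ {t} → j ≤ t → t ≤ i → h j + k i < h i + k t
    right : ∀ {t} → i < t → t ≤ N →
            Within (suc i) t λ s → h s ≤ h j ⊎ h s + k (suc i) ≤ h (suc i) + k t

record Opening (h k : ℕ → ℕ) (i j : ℕ) : Set where
  field
    above-h : ∀ {t} → i < t → t ≤ j → h (suc i) ≤ h t
    above-k : ∀ {t} → i < t → t ≤ j → k (suc i) ≤ k t

-- Levels before (h, k) and after (h′, k′) a promotion.  The unprimed functions are
-- indexed from the second letter on, so that positions agree; p is the place of w_ι in
-- that indexing, M + 1 the length of the word, and a (b) is 1 if w_ι is counted by
-- h (k), 0 otherwise.
record Slide (a b p M : ℕ) (h k h′ k′ : ℕ → ℕ) : Set where
  field
    before-h : ∀ {t} → t ≤ p → h t ≡ suc (h′ t)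
    before-k : ∀ {t} → t ≤ p → k t ≡ suc (k′ t)
    after-h  : ∀ {t} → p < t → t ≤ M → a + h t ≡ h′ t
    after-k  : ∀ {t} → p < t → t ≤ M → b + k t ≡ k′ t
    end-h    : h′ (suc M) ≡ 0
    end-k    : k′ (suc M) ≡ 0

-- What survives when the relevant positions lie on one side of w_ι

module Uniform {a b p M h k h′ k′} (S : Slide a b p M h k h′ k′) where
  open Slide S public

  before-≤ : ∀ {s t u v} → s ≤ p → t ≤ p → u ≤ p → v ≤ p →
             h s + k t ≤ h u + k v → h′ s + k′ t ≤ h′ u + k′ v
  -- Up to `p` both levels fall by 1, so each side of a mixed inequality falls by 2.
  before-≤ s≤ t≤ u≤ v≤ = shift-≤ {0} {2} (shift-+ {0} {1} {0} {1} (before-h s≤) (before-k t≤))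
                                         (shift-+ {0} {1} {0} {1} (before-h u≤) (before-k v≤))

  before-< : ∀ {s t u v} → s ≤ p → t ≤ p → u ≤ p → v ≤ p →
             h s + k t < h u + k v → h′ s + k′ t < h′ u + k′ v
  before-< s≤ t≤ u≤ v≤ = shift-< {0} {2} (shift-+ {0} {1} {0} {1} (before-h s≤) (before-k t≤))
                                         (shift-+ {0} {1} {0} {1} (before-h u≤) (before-k v≤))

  before-h-≤ : ∀ {s t} → s ≤ p → t ≤ p → h s ≤ h t → h′ s ≤ h′ t
  before-h-≤ s≤ t≤ = shift-≤ {0} {1} (before-h s≤) (before-h t≤)

  before-k-≤ : ∀ {s t} → s ≤ p → t ≤ p → k s ≤ k t → k′ s ≤ k′ t
  before-k-≤ s≤ t≤ = shift-≤ {0} {1} (before-k s≤) (before-k t≤)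

  before-k-< : ∀ {s t} → s ≤ p → t ≤ p → k s < k t → k′ s < k′ t
  before-k-< s≤ t≤ = shift-< {0} {1} (before-k s≤) (before-k t≤)

  Late : ℕ → Set
  Late t = p < t × t ≤ M

  after-+ : ∀ {s t} → Late s → Late t → (a + b) + (h s + k t) ≡ 0 + (h′ s + k′ t)
  after-+ (p<s , s≤) (p<t , t≤) = shift-+ {a} {0} {b} {0} (after-h p<s s≤) (after-k p<t t≤)

  after-≤ : ∀ {s t u v} → Late s → Late t → Late u → Late v →
            h s + k t ≤ h u + k v → h′ s + k′ t ≤ h′ u + k′ v
  after-≤ s t u v = shift-≤ {a + b} {0} (after-+ s t) (after-+ u v)

  after-< : ∀ {s t u v} → Late s → Late t → Late u → Late v →
            h s + k t < h u + k v → h′ s + k′ t < h′ u + k′ v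
  after-< s t u v = shift-< {a + b} {0} (after-+ s t) (after-+ u v)

  after-h-≤ : ∀ {s t} → Late s → Late t → h s ≤ h t → h′ s ≤ h′ t
  after-h-≤ (p<s , s≤) (p<t , t≤) = shift-≤ {a} {0} (after-h p<s s≤) (after-h p<t t≤)

  after-k-≤ : ∀ {s t} → Late s → Late t → k s ≤ k t → k′ s ≤ k′ t
  after-k-≤ (p<s , s≤) (p<t , t≤) = shift-≤ {b} {0} (after-k p<s s≤) (after-k p<t t≤)

  after-k-< : ∀ {s t} → Late s → Late t → k s < k t → k′ s < k′ t
  after-k-< (p<s , s≤) (p<t , t≤) = shift-< {b} {0} (after-k p<s s≤) (after-k p<t t≤)

  opening-early : ∀ {i j} → i < j → j < p → Opening h k i j → Opening h′ k′ i j
  opening-early {i} {j} i<j j<p O = record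
    { above-h = λ i<t t≤j → before-h-≤ 1+i≤p (≤-trans t≤j (<⇒≤ j<p)) (above-h i<t t≤j)
    ; above-k = λ i<t t≤j → before-k-≤ 1+i≤p (≤-trans t≤j (<⇒≤ j<p)) (above-k i<t t≤j) }
    where
    open Opening O
    1+i≤p : suc i ≤ p
    1+i≤p = <-trans i<j j<p

  opening-late : ∀ {i j} → p < i → i < j → j ≤ M → Opening h k i j → Opening h′ k′ i j
  opening-late {i} {j} p<i i<j j≤M O = record
    { above-h = λ i<t t≤j → after-h-≤ late (<-trans p<i i<t , ≤-trans t≤j j≤M) (above-h i<t t≤j)
    ; above-k = λ i<t t≤j → after-k-≤ late (<-trans p<i i<t , ≤-trans t≤j j≤M) (above-k i<t t≤j) }
    where
    open Opening O
    late : Late (suc i)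
    late = m<n⇒m<1+n p<i , ≤-trans i<j j≤M

  forward-early : ∀ {i j} → i < j → j < p → Forward h k i j → Forward h′ k′ i j
  forward-early {i} {j} i<j j<p F = record
    { right = λ i<t t≤j → let s , i<s , s≤t , le = right i<t t≤j in
        s , i<s , s≤t , before-≤ (early (≤-trans s≤t t≤j)) 1+i≤p 1+i≤p (early t≤j) le
    ; floor = λ i<t t≤j → before-≤ 1+i≤p (early ≤-refl) (early t≤j) 1+i≤p (floor i<t t≤j)
    ; left = λ {t} t≤i → let s , t≤s , s≤i , alt = left t≤i in
        s , t≤s , s≤i , left′ t≤i s≤i alt }
    where
    open Forward F
    early : ∀ {t} → t ≤ j → t ≤ p
    early t≤j = ≤-trans t≤j (<⇒≤ j<p)
    1+i≤p : suc i ≤ p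
    1+i≤p = early i<j
    i≤p : i ≤ p
    i≤p = <⇒≤ 1+i≤p
    left′ : ∀ {s t} → t ≤ i → s ≤ i → k s < k j ⊎ h i + k s ≤ h t + k i →
            k′ s < k′ j ⊎ h′ i + k′ s ≤ h′ t + k′ i
    left′ t≤i s≤i (inj₁ lt) = inj₁ (before-k-< (≤-trans s≤i i≤p) (early ≤-refl) lt)
    left′ t≤i s≤i (inj₂ le) = inj₂ (before-≤ i≤p (≤-trans s≤i i≤p) (≤-trans t≤i i≤p) i≤p le)

  -- For `t ≤ p` the inequality in `left` compares positions on both sides of `p` and may be lost.
  -- The extra witness beyond `p` settles all these `t` by the first alternative.
  forward-late : ∀ {i j} → p < i → i < j → j ≤ M → Within (suc p) i (λ s → k s < k j) →
                 Forward h k i j → Forward h′ k′ i j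
  forward-late {i} {j} p<i i<j j≤M (s₀ , p<s₀ , s₀≤i , low) F = record
    { right = λ i<t t≤j → let s , i<s , s≤t , le = right i<t t≤j in
        s , i<s , s≤t ,
        after-≤ (late (<-trans p<i i<s) (≤-trans s≤t t≤j)) late₁ late₁
                (late (<-trans p<i i<t) t≤j) le
    ; floor = λ i<t t≤j →
        after-≤ late₁ (late (<-trans p<i i<j) ≤-refl) (late (<-trans p<i i<t) t≤j) late₁
                (floor i<t t≤j)
    ; left = left′ }
    where
    open Forward F
    late : ∀ {t} → p < t → t ≤ j → Late t
    late p<t t≤j = p<t , ≤-trans t≤j j≤M
    late₁ : Late (suc i)
    late₁ = late (m<n⇒m<1+n p<i) i<j
    lateᵢ : ∀ {t} → p < t → t ≤ i → Late t
    lateᵢ p<t t≤i = late p<t (≤-trans t≤i (<⇒≤ i<j))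
    left′ : ∀ {t} → t ≤ i → Within t i λ s → k′ s < k′ j ⊎ h′ i + k′ s ≤ h′ t + k′ i
    left′ {t} t≤i with p <? t
    ... | no p≮t = s₀ , ≤-trans (≮⇒≥ p≮t) (<⇒≤ p<s₀) , s₀≤i ,
                   inj₁ (after-k-< (lateᵢ p<s₀ s₀≤i) (late (<-trans p<i i<j) ≤-refl) low)
    ... | yes p<t with left t≤i
    ...   | s , t≤s , s≤i , inj₁ lt =
              s , t≤s , s≤i ,
              inj₁ (after-k-< (lateᵢ (<-≤-trans p<t t≤s) s≤i) (late (<-trans p<i i<j) ≤-refl) lt)
    ...   | s , t≤s , s≤i , inj₂ le =
              s , t≤s , s≤i ,
              inj₂ (after-≤ (lateᵢ p<i ≤-refl) (lateᵢ (<-≤-trans p<t t≤s) s≤i) (lateᵢ p<t t≤i)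
                            (lateᵢ p<i ≤-refl) le)

  -- The new word reaches one position further in this indexing. There its level is back at 0, so
  -- the first alternative holds.
  extend-right : ∀ {i j} → i ≤ M →
    (∀ {t} → i < t → t ≤ M →
       Within (suc i) t λ s → h′ s ≤ h′ j ⊎ h′ s + k′ (suc i) ≤ h′ (suc i) + k′ t) →
    ∀ {t} → i < t → t ≤ suc M →
       Within (suc i) t λ s → h′ s ≤ h′ j ⊎ h′ s + k′ (suc i) ≤ h′ (suc i) + k′ t
  extend-right {i} {j} i≤M right {t} i<t t≤1+M with t ≤? M
  ... | yes t≤M = right i<t t≤M
  ... | no t≰M rewrite ≤-antisym t≤1+M (≰⇒> t≰M) =
          suc M , i<t , ≤-refl , inj₁ (subst (_≤ h′ j) (sym end-h) z≤n)

  backward-late : ∀ {i j} → p < j → j < i → i < M → Backward M h k i j → Backward (suc M) h′ k′ i j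
  backward-late {i} {j} p<j j<i i<M T = record
    { left = λ j<t t≤i → let s , t≤s , s≤i , le = left j<t t≤i in
        s , t≤s , s≤i ,
        after-≤ lateᵢ (late (≤-trans (<⇒≤ j<t) t≤s) s≤i) (late (<⇒≤ j<t) t≤i) lateᵢ le
    ; floor = λ j≤t t≤i → after-< lateⱼ lateᵢ lateᵢ (late j≤t t≤i) (floor j≤t t≤i)
    ; right = extend-right (<⇒≤ i<M) right′ }
    where
    open Backward T
    late : ∀ {t} → j ≤ t → t ≤ i → Late t
    late j≤t t≤i = <-≤-trans p<j j≤t , ≤-trans t≤i (<⇒≤ i<M)
    lateᵢ : Late i
    lateᵢ = late (<⇒≤ j<i) ≤-refl
    lateⱼ : Late j
    lateⱼ = late ≤-refl (<⇒≤ j<i)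
    late₁ : Late (suc i)
    late₁ = m<n⇒m<1+n (proj₁ lateᵢ) , i<M
    right′ : ∀ {t} → i < t → t ≤ M →
             Within (suc i) t λ s → h′ s ≤ h′ j ⊎ h′ s + k′ (suc i) ≤ h′ (suc i) + k′ t
    right′ i<t t≤M with right i<t t≤M
    ... | s , i<s , s≤t , inj₁ le =
            s , i<s , s≤t ,
            inj₁ (after-h-≤ (<-trans (proj₁ lateᵢ) i<s , ≤-trans s≤t t≤M) lateⱼ le)
    ... | s , i<s , s≤t , inj₂ le =
            s , i<s , s≤t ,
            inj₂ (after-≤ (<-trans (proj₁ lateᵢ) i<s , ≤-trans s≤t t≤M) late₁ late₁
                          (<-trans (proj₁ lateᵢ) i<t , t≤M) le)

  -- Once `t` has passed `p`, the levels at `i` and at `t` shift differently in `right`. The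
  -- supplied witness between them then serves every such `t`.
  backward-early : ∀ {i j} → j < i → i < p → p < M →
    Within (suc i) p (λ s → h′ s ≤ h′ j) →
    Backward M h k i j → Backward (suc M) h′ k′ i j
  backward-early {i} {j} j<i i<p p<M (s₀ , i<s₀ , s₀≤p , low) T = record
    { left = λ j<t t≤i → let s , t≤s , s≤i , le = left j<t t≤i in
        s , t≤s , s≤i , before-≤ i≤p (early s≤i) (early t≤i) i≤p le
    ; floor = λ j≤t t≤i → before-< (early (<⇒≤ j<i)) i≤p i≤p (early t≤i) (floor j≤t t≤i)
    ; right = extend-right (<⇒≤ (<-trans i<p p<M)) right′ }
    where
    open Backward T
    i≤p : i ≤ p
    i≤p = <⇒≤ i<p
    early : ∀ {t} → t ≤ i → t ≤ p
    early t≤i = ≤-trans t≤i i≤p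
    right′ : ∀ {t} → i < t → t ≤ M →
             Within (suc i) t λ s → h′ s ≤ h′ j ⊎ h′ s + k′ (suc i) ≤ h′ (suc i) + k′ t
    right′ {t} i<t t≤M with p <? t
    ... | yes p<t = s₀ , i<s₀ , ≤-trans s₀≤p (<⇒≤ p<t) , inj₁ low
    ... | no p≮t with right i<t t≤M
    ...   | s , i<s , s≤t , inj₁ le =
              s , i<s , s≤t , inj₁ (before-h-≤ (≤-trans s≤t (≮⇒≥ p≮t)) (early (<⇒≤ j<i)) le)
    ...   | s , i<s , s≤t , inj₂ le =
              s , i<s , s≤t , inj₂ (before-≤ (≤-trans s≤t (≮⇒≥ p≮t)) i<p i<p (≮⇒≥ p≮t) le)

  -- The witness of `left` for `t = 0` cannot lie at or before `p`: there `k` is positive, and since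
  -- `h i` exceeds `k i`, the value `h 0 = 1` leaves no room for that.
  turn-late : ∀ {i} → h 0 ≡ 1 → k i < h i →
              (∀ {t} → t ≤ i → Within t i λ s → h i + k s ≤ h t + k i) → p < i
  turn-late {i} h₀ kᵢ<hᵢ left with left z≤n
  ... | s , _ , s≤i , le with p <? s
  ...   | yes p<s = <-≤-trans p<s s≤i
  ...   | no p≮s = contradiction (begin
            suc (k i) + 1          ≤⟨ +-mono-≤ kᵢ<hᵢ (s≤s z≤n) ⟩
            h i + suc (k′ s)       ≡⟨ cong (h i +_) (before-k (≮⇒≥ p≮s)) ⟨
            h i + k s              ≤⟨ le ⟩
            h 0 + k i              ≡⟨ cong (_+ k i) h₀ ⟩
            suc (k i)              ∎) (<⇒≱ (m<m+n (suc (k i)) (s≤s z≤n)))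
    where open ≤-Reasoning

  opening-step : ∀ {i j} → i < j → j ≤ M → p ≢ i → (i < p → p ≤ j → ⊥) →
                 Opening h k i j → Opening h′ k′ i j
  opening-step {i} {j} i<j j≤M p≢i apart O with <-cmp p i | p ≤? j
  ... | tri< p<i _ _ | _ = opening-late p<i i<j j≤M O
  ... | tri≈ _ p≡i _ | _ = contradiction p≡i p≢i
  ... | tri> _ _ i<p | yes p≤j = ⊥-elim (apart i<p p≤j)
  ... | tri> _ _ _ | no p≰j = opening-early i<j (≰⇒> p≰j) O

-- Promotions in which w_ι is an occurrence of c

module SlideOwn {p M h k h′ k′} (S : Slide 1 0 p M h k h′ k′)
                (hit : h (suc p) ≡ 0) (touch : h′ p ≡ 0) where
  open Uniform S

  -- Supplies the witness wanted by `forward-late`. `left` is read just behind `p`, where `h` is 0,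
  -- and joined with `right` at `j`; strictness comes from the descent of `h` at `i`.
  forward-low : ∀ {i j} → p < i → i < j → h i ≡ suc (h (suc i)) → k (suc i) ≡ k i →
                Forward h k i j → Within (suc p) i λ s → k s < k j
  forward-low {i} {j} p<i i<j hᵢ kᵢ F with left p<i | right i<j ≤-refl
    where open Forward F
  ... | s , p<s , s≤i , inj₁ lt | _ = s , p<s , s≤i , lt
  ... | s , p<s , s≤i , inj₂ le | s₁ , _ , _ , le₁ =
        s , p<s , s≤i , +-cancelˡ-≤ (h (suc i)) _ _ (begin
          h (suc i) + suc (k s) ≡⟨ +-suc (h (suc i)) (k s) ⟩
          suc (h (suc i)) + k s ≡⟨ cong (_+ k s) hᵢ ⟨
          h i + k s             ≤⟨ le ⟩
          h (suc p) + k i       ≡⟨ cong₂ _+_ hit (sym kᵢ) ⟩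
          k (suc i)             ≤⟨ m≤n+m (k (suc i)) (h s₁) ⟩
          h s₁ + k (suc i)      ≤⟨ le₁ ⟩
          h (suc i) + k j       ∎)
    where open ≤-Reasoning

  forward-across : ∀ {i j} → i < p → p < j → j ≤ M → Forward h k i j → Forward h′ k′ i j
  forward-across {i} {j} i<p p<j j≤M F = record
    { right = right′
    ; floor = λ {t} _ _ → ≤-trans high (m≤n+m (k′ (suc i)) (h′ t))
    ; left = λ t≤i → let s , t≤s , s≤i , alt = left t≤i in s , t≤s , s≤i , left′ t≤i s≤i alt }
    where
    open Forward F
    open ≤-Reasoning
    early : ∀ {t} → t ≤ i → t ≤ p
    early t≤i = ≤-trans t≤i (<⇒≤ i<p)
    -- This is the old `floor` at `suc p`, where `h` is 0. It bounds the new `floor` for every `t`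
    -- at once.
    high : h′ (suc i) + k′ j ≤ k′ (suc i)
    high = s≤s⁻¹ (begin
      suc (h′ (suc i)) + k′ j ≡⟨ cong₂ _+_ (before-h i<p) (after-k p<j j≤M) ⟨
      h (suc i) + k j         ≤⟨ floor (m<n⇒m<1+n i<p) p<j ⟩
      h (suc p) + k (suc i)   ≡⟨ cong₂ _+_ hit (before-k i<p) ⟩
      suc (k′ (suc i))        ∎)
    right′ : ∀ {t} → i < t → t ≤ j →
             Within (suc i) t λ s → h′ s + k′ (suc i) ≤ h′ (suc i) + k′ t
    right′ {t} i<t t≤j with p <? t | right i<t t≤j
    ... | no p≮t | s , i<s , s≤t , le =
          s , i<s , s≤t , before-≤ (≤-trans s≤t (≮⇒≥ p≮t)) i<p i<p (≮⇒≥ p≮t) le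
    ... | yes p<t | s , _ , _ , le =
          -- Past `p` the witness is `p` itself, where `h′` touches 0.
          p , i<p , <⇒≤ p<t , s≤s⁻¹ (begin
            suc (h′ p + k′ (suc i)) ≡⟨ cong (λ m → suc (m + k′ (suc i))) touch ⟩
            suc (k′ (suc i))        ≡⟨ before-k i<p ⟨
            k (suc i)               ≤⟨ m≤n+m (k (suc i)) (h s) ⟩
            h s + k (suc i)         ≤⟨ le ⟩
            h (suc i) + k t         ≡⟨ cong₂ _+_ (before-h i<p) (after-k p<t (≤-trans t≤j j≤M)) ⟩
            suc (h′ (suc i) + k′ t) ∎)
    left′ : ∀ {s t} → t ≤ i → s ≤ i → k s < k j ⊎ h i + k s ≤ h t + k i →
            k′ s < k′ j ⊎ h′ i + k′ s ≤ h′ t + k′ i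
    left′ {s} t≤i s≤i (inj₁ lt) = inj₁ (begin
      suc (k′ s) ≡⟨ before-k (early s≤i) ⟨
      k s        ≤⟨ <⇒≤ lt ⟩
      k j        ≡⟨ after-k p<j j≤M ⟩
      k′ j       ∎)
    left′ t≤i s≤i (inj₂ le) =
      inj₂ (before-≤ (early ≤-refl) (early s≤i) (early t≤i) (early ≤-refl) le)

  -- Behind `p` the level `h` starts from 0, its least possible value. So the condition on `h` is
  -- free, and `right` loses its `h` terms and becomes the condition on `k`.
  forward-opens : ∀ {j} → p < j → j ≤ M → Forward h k p j → Opening h′ k′ p j
  forward-opens {j} p<j j≤M F = record
    { above-h = λ {t} i<t t≤j → after-h-≤ late₁ (i<t , ≤-trans t≤j j≤M) (subst (_≤ h t) (sym hit) z≤n)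
    ; above-k = λ {t} i<t t≤j → after-k-≤ late₁ (i<t , ≤-trans t≤j j≤M)
        (let s , _ , _ , le = right i<t t≤j in begin
          k (suc p)       ≤⟨ m≤n+m (k (suc p)) (h s) ⟩
          h s + k (suc p) ≤⟨ le ⟩
          h (suc p) + k t ≡⟨ cong (_+ k t) hit ⟩
          k t             ∎) }
    where
    open Forward F
    open ≤-Reasoning
    late₁ : Late (suc p)
    late₁ = ≤-refl , ≤-trans p<j j≤M

  forward-own : ∀ {i j} → i < j → j ≤ M → p ≢ j → h i ≡ suc (h (suc i)) → k (suc i) ≡ k i →
                Forward h k i j → (p ≢ i × Forward h′ k′ i j) ⊎ (p ≡ i × Opening h′ k′ i j)
  forward-own {i} {j} i<j j≤M p≢j hᵢ kᵢ F with <-cmp p i | <-cmp p j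
  ... | tri< p<i p≢i _ | _ = inj₁ (p≢i , forward-late p<i i<j j≤M (forward-low p<i i<j hᵢ kᵢ F) F)
  ... | tri≈ _ refl _ | _ = inj₂ (refl , forward-opens i<j j≤M F)
  ... | tri> _ p≢i i<p | tri< p<j _ _ = inj₁ (p≢i , forward-across i<p p<j j≤M F)
  ... | tri> _ _ _ | tri≈ _ p≡j _ = contradiction p≡j p≢j
  ... | tri> _ p≢i i<p | tri> _ _ j<p = inj₁ (p≢i , forward-early i<j j<p F)

  -- Taking `t = p` in `floor` cancels `k` and puts `h′ j` strictly below `h′ p`, which is 0. So the
  -- copy of c is not w_ι while its `A` is still on the way to the front.
  backward-special : ∀ {j} → j < p → Backward M h k p j → ⊥
  backward-special {j} j<p T = n≮0 (begin-strict
      h′ j <⟨ s≤s⁻¹ (subst₂ _<_ (before-h (<⇒≤ j<p)) (before-h ≤-refl)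
                      (+-cancelʳ-< (k p) _ _ (floor (<⇒≤ j<p) ≤-refl))) ⟩
      h′ p ≡⟨ touch ⟩
      0    ∎)
    where
    open Backward T
    open ≤-Reasoning

  backward-own : ∀ {i j} → j < i → i < M → p < M → p ≢ j →
                 Backward M h k i j → Backward (suc M) h′ k′ i j
  backward-own {i} {j} j<i i<M p<M p≢j T with <-cmp p j | <-cmp p i
  ... | tri< p<j _ _ | _ = backward-late p<j j<i i<M T
  ... | tri≈ _ p≡j _ | _ = contradiction p≡j p≢j
  -- The order `j < p < i` cannot occur: the witness of `left` for `suc p`, where `h` is 0, violates
  -- `floor`.
  ... | tri> _ _ j<p | tri< p<i _ _ = ⊥-elim (n≮n (k i) (begin-strict
      k i             ≤⟨ m≤n+m (k i) (h j) ⟩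
      h j + k i       <⟨ floor (≤-trans (<⇒≤ j<p) (<⇒≤ (proj₁ (proj₂ l)))) (proj₁ (proj₂ (proj₂ l))) ⟩
      h i + k (proj₁ l) ≤⟨ proj₂ (proj₂ (proj₂ l)) ⟩
      h (suc p) + k i ≡⟨ cong (_+ k i) hit ⟩
      k i             ∎))
    where
    open Backward T
    open ≤-Reasoning
    l : Within (suc p) i λ s → h i + k s ≤ h (suc p) + k i
    l = left (m<n⇒m<1+n j<p) p<i
  ... | tri> _ _ _ | tri≈ _ refl _ = ⊥-elim (backward-special j<i T)
  ... | tri> _ _ _ | tri> _ _ i<p =
        backward-early j<i i<p p<M (p , i<p , ≤-refl , subst (_≤ h′ j) (sym touch) z≤n) T

  -- The tie is born here: at the copy's position `M` the level `h′` is 1 and `k′` is 0, while `h′`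
  -- is 0 in front of the new `A` at `p`. Beyond `M` only the end of the word is left, which
  -- `extend-right` covers.
  backward-new : p < M → h M ≡ 0 → k M ≡ 0 → Backward (suc M) h′ k′ M p
  backward-new p<M hM kM = record
    { left = λ {t} p<t t≤M → M , t≤M , ≤-refl ,
        +-monoˡ-≤ (k′ M) (subst₂ _≤_ (trans (cong suc (sym hM)) (after-h p<M ≤-refl))
                                     (after-h p<t t≤M) (s≤s z≤n))
    ; floor = λ {t} _ _ → subst₂ _<_ (sym (cong₂ _+_ touch (trans (sym (after-k p<M ≤-refl)) kM)))
                                     (cong (_+ k′ t) (after-h p<M ≤-refl)) (s≤s z≤n)
    ; right = extend-right ≤-refl (λ M<t t≤M → contradiction t≤M (<⇒≱ M<t)) }

  -- Excludes that the leading `A` is closed by c itself: `left` just behind `p`, where `h` is 0,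
  -- would give `h i ≤ k i`.
  turn-own : ∀ {i} → h 0 ≡ 1 → k i < h i →
             (∀ {t} → t ≤ i → Within t i λ s → h i + k s ≤ h t + k i) → ⊥
  turn-own {i} h₀ kᵢ<hᵢ left with left (turn-late h₀ kᵢ<hᵢ left)
  ... | s , _ , _ , le = n≮n (k i) (begin-strict
        k i             <⟨ kᵢ<hᵢ ⟩
        h i             ≤⟨ m≤m+n (h i) (k s) ⟩
        h i + k s       ≤⟨ le ⟩
        h (suc p) + k i ≡⟨ cong (_+ k i) hit ⟩
        k i             ∎)
    where open ≤-Reasoning

-- Promotions in which w_ι is the letter other than c

module SlideOther {p M h k h′ k′} (S : Slide 0 1 p M h k h′ k′)
                  (hit : k (suc p) ≡ 0) (touch : k′ p ≡ 0) (flat : h (suc p) ≡ h p) where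
  open Uniform S

  forward-other : ∀ {i j} → i < j → j ≤ M → p ≢ i →
                  h i ≡ suc (h (suc i)) → k (suc i) ≡ k i → 0 < k j → h 0 ≡ 1 →
                  Forward h k i j → p ≢ j × Forward h′ k′ i j
  forward-other {i} {j} i<j j≤M p≢i hᵢ kᵢ 0<kⱼ h₀ F with <-cmp p i | <-cmp p j
  ... | tri< p<i _ _ | _ =
        <⇒≢ (<-trans p<i i<j) ,
        forward-late p<i i<j j≤M (suc p , ≤-refl , p<i , subst (_< k j) (sym hit) 0<kⱼ) F
  ... | tri≈ _ p≡i _ | _ = contradiction p≡i p≢i
  -- The order `i < p < j` is impossible: `floor` at the witness that `right` gives for `suc p`
  -- yields `k j ≤ k (suc p) = 0`.
  ... | tri> _ _ i<p | tri< p<j _ _ = ⊥-elim (<⇒≱ 0<kⱼ (+-cancelˡ-≤ (h (suc i)) _ _ (begin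
      h (suc i) + k j         ≤⟨ floor (proj₁ (proj₂ r)) (≤-trans (proj₁ (proj₂ (proj₂ r))) p<j) ⟩
      h (proj₁ r) + k (suc i) ≤⟨ proj₂ (proj₂ (proj₂ r)) ⟩
      h (suc i) + k (suc p)   ≡⟨ cong (h (suc i) +_) hit ⟩
      h (suc i) + 0           ∎)))
    where
    open Forward F
    open ≤-Reasoning
    r : Within (suc i) (suc p) λ s → h s + k (suc i) ≤ h (suc i) + k (suc p)
    r = right (m<n⇒m<1+n i<p) p<j
  -- If `p = j`, then `k j` is 1, so `left` at 0 gives `h i ≤ k i` and `right` at `j` gives
  -- `k (suc i) ≤ h (suc i)`, although only `h` descends at `i`.
  ... | tri> _ _ i<p | tri≈ _ refl _ = ⊥-elim (n≮n (h (suc i)) (begin-strict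
      h (suc i) <⟨ ≤-reflexive (sym hᵢ) ⟩
      h i       ≤⟨ hᵢ≤kᵢ ⟩
      k i       ≡⟨ kᵢ ⟨
      k (suc i) ≤⟨ kᵢ₊₁≤hᵢ₊₁ ⟩
      h (suc i) ∎))
    where
    open Forward F
    open ≤-Reasoning
    kₚ : k p ≡ 1
    kₚ = trans (before-k ≤-refl) (cong suc touch)
    hᵢ≤kᵢ : h i ≤ k i
    hᵢ≤kᵢ with left z≤n
    ... | s , _ , s≤i , inj₁ lt =
          contradiction (subst₂ _<_ (before-k (≤-trans s≤i (<⇒≤ i<p))) kₚ lt) λ { (s≤s ()) }
    ... | s , _ , s≤i , inj₂ le = s≤s⁻¹ (begin
          suc (h i)           ≤⟨ s≤s (m≤m+n (h i) (k′ s)) ⟩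
          suc (h i + k′ s)    ≡⟨ +-suc (h i) (k′ s) ⟨
          h i + suc (k′ s)    ≡⟨ cong (h i +_) (before-k (≤-trans s≤i (<⇒≤ i<p))) ⟨
          h i + k s           ≤⟨ le ⟩
          h 0 + k i           ≡⟨ cong (_+ k i) h₀ ⟩
          suc (k i)           ∎)
    kᵢ₊₁≤hᵢ₊₁ : k (suc i) ≤ h (suc i)
    kᵢ₊₁≤hᵢ₊₁ with right i<j ≤-refl
    ... | s , _ , s≤p , le = s≤s⁻¹ (begin
          suc (k (suc i))        ≤⟨ s≤s (m≤n+m (k (suc i)) (h′ s)) ⟩
          suc (h′ s) + k (suc i) ≡⟨ cong (_+ k (suc i)) (before-h s≤p) ⟨
          h s + k (suc i)        ≤⟨ le ⟩
          h (suc i) + k p        ≡⟨ cong (h (suc i) +_) kₚ ⟩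
          h (suc i) + 1          ≡⟨ +-comm (h (suc i)) 1 ⟩
          suc (h (suc i))        ∎)
  ... | tri> _ _ _ | tri> _ p≢j j<p = p≢j , forward-early i<j j<p F

  -- The witness comes from `right` at `suc p`, where `k` is 0. By `steep`, which is `left` read
  -- just behind the `A`, even the second alternative forces `h s ≤ h j`.
  backward-low : ∀ {i j} → j < i → i < p → p < M →
                 h i ≡ suc (h (suc i)) → k (suc i) ≡ k i → h (suc j) ≡ suc (h j) →
                 Backward M h k i j → Within (suc i) p λ s → h′ s ≤ h′ j
  backward-low {i} {j} j<i i<p p<M hᵢ kᵢ hⱼ T = finish (right (m<n⇒m<1+n i<p) p<M)
    where
    open Backward T
    open ≤-Reasoning
    steep : suc (h (suc i)) ≤ h j + k (suc i)
    steep with left ≤-refl j<i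
    ... | s , _ , s≤i , le = s≤s⁻¹ (begin
          suc (suc (h (suc i)))          ≤⟨ s≤s (m≤m+n _ (k′ s)) ⟩
          suc (suc (h (suc i)) + k′ s)   ≡⟨ +-suc (suc (h (suc i))) (k′ s) ⟨
          suc (h (suc i)) + suc (k′ s)   ≡⟨ cong₂ _+_ hᵢ (before-k (≤-trans s≤i (<⇒≤ i<p))) ⟨
          h i + k s                      ≤⟨ le ⟩
          h (suc j) + k i                ≡⟨ cong₂ _+_ hⱼ (sym kᵢ) ⟩
          suc (h j + k (suc i))          ∎)
    low : ∀ {s} → h s ≤ h j ⊎ h s + k (suc i) ≤ h (suc i) + k (suc p) → h s ≤ h j
    low (inj₁ le) = le
    low {s} (inj₂ le) = +-cancelʳ-≤ (k (suc i)) _ _ (begin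
      h s + k (suc i)       ≤⟨ le ⟩
      h (suc i) + k (suc p) ≡⟨ cong (h (suc i) +_) hit ⟩
      h (suc i) + 0         ≡⟨ +-identityʳ _ ⟩
      h (suc i)             ≤⟨ n≤1+n _ ⟩
      suc (h (suc i))       ≤⟨ steep ⟩
      h j + k (suc i)       ∎)
    j≤p : j ≤ p
    j≤p = <⇒≤ (<-trans j<i i<p)
    finish : Within (suc i) (suc p) (λ s → h s ≤ h j ⊎ h s + k (suc i) ≤ h (suc i) + k (suc p)) →
             Within (suc i) p λ s → h′ s ≤ h′ j
    finish (s , i<s , s≤1+p , alt) with s ≤? p
    ... | yes s≤p = s , i<s , s≤p , before-h-≤ s≤p j≤p (low alt)
    -- A witness at `suc p` is moved back to `p`, since w_ι does not change `h`.
    ... | no s≰p rewrite ≤-antisym s≤1+p (≰⇒> s≰p) =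
          p , i<p , ≤-refl , before-h-≤ ≤-refl j≤p (subst (_≤ h j) flat (low alt))

  -- The levels at `j` and `i` shift differently here. The old `floor` at `suc p`, where `k` is 0,
  -- gives `gap`; this alone yields the new `floor` and turns the first alternative of `right` into
  -- the second. For `t ≤ p`, the witness of `left` is `p`, where `k′` touches 0.
  backward-across : ∀ {i j} → j < p → p < i → i < M →
                    h i ≡ suc (h (suc i)) → k (suc i) ≡ k i →
                    Backward M h k i j → Backward (suc M) h′ k′ i j
  backward-across {i} {j} j<p p<i i<M hᵢ kᵢ T = record
    { left = left′
    ; floor = λ {t} _ _ → high t
    ; right = extend-right (<⇒≤ i<M) right′ }
    where
    open Backward T
    open ≤-Reasoning
    lateᵢ : Late i
    lateᵢ = p<i , <⇒≤ i<M
    late₁ : Late (suc i)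
    late₁ = m<n⇒m<1+n p<i , i<M
    gap : h j + k i < h i
    gap = begin-strict
      h j + k i       <⟨ floor (<⇒≤ (m<n⇒m<1+n j<p)) p<i ⟩
      h i + k (suc p) ≡⟨ cong (h i +_) hit ⟩
      h i + 0         ≡⟨ +-identityʳ _ ⟩
      h i             ∎
    high : ∀ t → h′ j + k′ i < h′ i + k′ t
    high t = begin-strict
      h′ j + k′ i           <⟨ ≤-refl ⟩
      suc (h′ j) + k′ i     ≡⟨ cong₂ _+_ (sym (before-h (<⇒≤ j<p))) (sym (after-k p<i (<⇒≤ i<M))) ⟩
      h j + suc (k i)       ≡⟨ +-suc (h j) (k i) ⟩
      suc (h j + k i)       ≤⟨ gap ⟩
      h i                   ≡⟨ after-h p<i (<⇒≤ i<M) ⟩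
      h′ i                  ≤⟨ m≤m+n (h′ i) (k′ t) ⟩
      h′ i + k′ t           ∎
    left′ : ∀ {t} → j < t → t ≤ i → Within t i λ s → h′ i + k′ s ≤ h′ t + k′ i
    left′ {t} j<t t≤i with p <? t | left j<t t≤i
    ... | yes p<t | s , t≤s , s≤i , le =
          s , t≤s , s≤i ,
          after-≤ lateᵢ (<-≤-trans p<t t≤s , ≤-trans s≤i (<⇒≤ i<M))
                  (p<t , ≤-trans t≤i (<⇒≤ i<M)) lateᵢ le
    ... | no p≮t | s , _ , _ , le =
          p , ≮⇒≥ p≮t , <⇒≤ p<i , (begin
            h′ i + k′ p          ≡⟨ cong₂ _+_ (sym (after-h p<i (<⇒≤ i<M))) touch ⟩
            h i + 0              ≤⟨ +-monoʳ-≤ (h i) z≤n ⟩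
            h i + k s            ≤⟨ le ⟩
            h t + k i            ≡⟨ cong (_+ k i) (before-h (≮⇒≥ p≮t)) ⟩
            suc (h′ t) + k i     ≡⟨ +-suc (h′ t) (k i) ⟨
            h′ t + suc (k i)     ≡⟨ cong (h′ t +_) (after-k p<i (<⇒≤ i<M)) ⟩
            h′ t + k′ i          ∎)
    right′ : ∀ {t} → i < t → t ≤ M →
             Within (suc i) t λ s → h′ s ≤ h′ j ⊎ h′ s + k′ (suc i) ≤ h′ (suc i) + k′ t
    right′ {t} i<t t≤M with right i<t t≤M
    ... | s , i<s , s≤t , alt =
          s , i<s , s≤t ,
          inj₂ (after-≤ (<-trans p<i i<s , ≤-trans s≤t t≤M) late₁ late₁ (<-trans p<i i<t , t≤M)
                        (below alt))
      where
      below : h s ≤ h j ⊎ h s + k (suc i) ≤ h (suc i) + k t → h s + k (suc i) ≤ h (suc i) + k t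
      below (inj₂ le) = le
      below (inj₁ le) = s≤s⁻¹ (begin
        suc (h s + k (suc i))   ≤⟨ s≤s (+-mono-≤ le (≤-reflexive kᵢ)) ⟩
        suc (h j + k i)         ≤⟨ gap ⟩
        h i                     ≡⟨ hᵢ ⟩
        suc (h (suc i))         ≤⟨ s≤s (m≤m+n _ (k t)) ⟩
        suc (h (suc i) + k t)   ∎)

  backward-other : ∀ {i j} → j < i → i < M → p < M → p ≢ i → p ≢ j →
                   h i ≡ suc (h (suc i)) → k (suc i) ≡ k i → h (suc j) ≡ suc (h j) →
                   Backward M h k i j → Backward (suc M) h′ k′ i j
  backward-other {i} {j} j<i i<M p<M p≢i p≢j hᵢ kᵢ hⱼ T with <-cmp p j | <-cmp p i
  ... | tri< p<j _ _ | _ = backward-late p<j j<i i<M T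
  ... | tri≈ _ p≡j _ | _ = contradiction p≡j p≢j
  ... | tri> _ _ j<p | tri< p<i _ _ = backward-across j<p p<i i<M hᵢ kᵢ T
  ... | tri> _ _ _ | tri≈ _ p≡i _ = contradiction p≡i p≢i
  ... | tri> _ _ _ | tri> _ _ i<p = backward-early j<i i<p p<M (backward-low j<i i<p p<M hᵢ kᵢ hⱼ T) T

  -- The `A` tied to the copy of c has come first, and the letter closing it lands at `M`. The 0 in
  -- the last hypothesis is the level in front of that `A`.
  turn-other : ∀ {i} → i < M → h i ≡ suc (h (suc i)) → k (suc i) ≡ k i → h 0 ≡ 1 → k M ≡ 0 → k i < h i →
               (∀ {t} → t ≤ i → Within t i λ s → h i + k s ≤ h t + k i) →
               (∀ {t} → i < t → t ≤ M →
                  Within (suc i) t λ s → h s ≤ 0 ⊎ h s + k (suc i) ≤ h (suc i) + k t) →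
               Forward h′ k′ i M
  turn-other {i} i<M hᵢ kᵢ h₀ kₘ kᵢ<hᵢ left right = record
    { right = right′
    ; floor = λ {t} i<t _ → (begin
        h′ (suc i) + k′ M       ≡⟨ cong₂ _+_ (sym (after-h p<1+i i<M)) k′ₘ ⟩
        h (suc i) + 1           ≡⟨ cong (_+ 1) level ⟩
        k (suc i) + 1           ≡⟨ +-comm (k (suc i)) 1 ⟩
        suc (k (suc i))         ≡⟨ after-k p<1+i i<M ⟩
        k′ (suc i)              ≤⟨ m≤n+m (k′ (suc i)) (h′ t) ⟩
        h′ t + k′ (suc i)       ∎)
    ; left = left′ }
    where
    open ≤-Reasoning
    p<i : p < i
    p<i = turn-late h₀ kᵢ<hᵢ left
    p<1+i : p < suc i
    p<1+i = m<n⇒m<1+n p<i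
    k′ₘ : k′ M ≡ 1
    k′ₘ = trans (sym (after-k (<-trans p<i i<M) ≤-refl)) (cong suc kₘ)
    hᵢ≤ : h i ≤ suc (k i)
    hᵢ≤ with left z≤n
    ... | s , _ , _ , le = begin
          h i       ≤⟨ m≤m+n (h i) (k s) ⟩
          h i + k s ≤⟨ le ⟩
          h 0 + k i ≡⟨ cong (_+ k i) h₀ ⟩
          suc (k i) ∎
    -- By `left` at 0, `h i` exceeds `k i` by exactly 1, and the letter c at `i` removes this
    -- excess.
    level : h (suc i) ≡ k (suc i)
    level = suc-injective (trans (sym hᵢ) (trans (≤-antisym hᵢ≤ kᵢ<hᵢ) (cong suc (sym kᵢ))))
    right′ : ∀ {t} → i < t → t ≤ M →
             Within (suc i) t λ s → h′ s + k′ (suc i) ≤ h′ (suc i) + k′ t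
    right′ {t} i<t t≤M with right i<t t≤M
    ... | s , i<s , s≤t , alt =
          s , i<s , s≤t ,
          after-≤ (<-trans p<i i<s , ≤-trans s≤t t≤M) (p<1+i , i<M) (p<1+i , i<M)
                  (<-trans p<i i<t , t≤M) (below alt)
      where
      below : h s ≤ 0 ⊎ h s + k (suc i) ≤ h (suc i) + k t → h s + k (suc i) ≤ h (suc i) + k t
      below (inj₂ le) = le
      below (inj₁ le) = ≤-trans (+-mono-≤ le (≤-reflexive (sym level))) (m≤m+n (h (suc i)) (k t))
    left′ : ∀ {t} → t ≤ i → Within t i λ s → k′ s < k′ M ⊎ h′ i + k′ s ≤ h′ t + k′ i
    left′ {t} t≤i with p <? t | left t≤i
    -- The last letter is counted by `k′`, so `k′ M` is 1 and `p`, where `k′` touches 0, meets the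
    -- first alternative.
    ... | no p≮t | _ = p , ≮⇒≥ p≮t , <⇒≤ p<i , inj₁ (subst₂ _<_ (sym touch) (sym k′ₘ) (s≤s z≤n))
    ... | yes p<t | s , t≤s , s≤i , le =
          s , t≤s , s≤i ,
          inj₂ (after-≤ (p<i , <⇒≤ i<M) (<-≤-trans p<t t≤s , ≤-trans s≤i (<⇒≤ i<M))
                        (p<t , ≤-trans t≤i (<⇒≤ i<M)) (p<i , <⇒≤ i<M) le)

-- Reindexing from the second letter on

module _ {h k : ℕ → ℕ} where

  forward-tail : ∀ {i j} → Forward h k (suc i) (suc j) → Forward (h ∘ suc) (k ∘ suc) i j
  forward-tail F = record
    { right = λ i<t t≤j → pred-within (right (s≤s i<t) (s≤s t≤j))
    ; floor = λ i<t t≤j → floor (s≤s i<t) (s≤s t≤j)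
    ; left = λ t≤i → pred-within (left (s≤s t≤i)) }
    where open Forward F

  backward-tail : ∀ {M i j} → Backward (suc M) h k (suc i) (suc j) →
                  Backward M (h ∘ suc) (k ∘ suc) i j
  backward-tail T = record
    { left = λ j<t t≤i → pred-within (left (s≤s j<t) (s≤s t≤i))
    ; floor = λ j≤t t≤i → floor (s≤s j≤t) (s≤s t≤i)
    ; right = λ i<t t≤M → pred-within (right (s≤s i<t) (s≤s t≤M)) }
    where open Backward T

  opening-tail : ∀ {i j} → Opening h k (suc i) (suc j) → Opening (h ∘ suc) (k ∘ suc) i j
  opening-tail O = record
    { above-h = λ i<t t≤j → above-h (s≤s i<t) (s≤s t≤j)
    ; above-k = λ i<t t≤j → above-k (s≤s i<t) (s≤s t≤j) }
    where open Opening O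

-- Letters, counts and levels of words

letter : Bool → Letter
letter true  = B
letter false = C

letter≢A : ∀ c → letter c ≢ A
letter≢A true ()
letter≢A false ()

letter-not : ∀ c → letter (not c) ≢ letter c
letter-not true ()
letter-not false ()

swap-letter : ∀ c → swapBC (letter c) ≡ letter (not c)
swap-letter true  = refl
swap-letter false = refl

-- A partial lookup: positions stay plain numbers, and the equation itself forces the position to be
-- in range.
At : Word → ℕ → Letter → Set
At w i x = head (drop i w) ≡ just x

At-unique : ∀ w i {x y} → At w i x → At w i y → x ≡ y
At-unique w i p q = just-injective (trans (sym p) q)

At-< : ∀ w i {x} → At w i x → i < length w
At-< (_ ∷ w) zero    _ = s≤s z≤n
At-< (_ ∷ w) (suc i) p = s≤s (At-< w i p)

take-suc-At : ∀ w i {x} → At w i x → take (suc i) w ≡ take i w ++ x ∷ []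
take-suc-At (_ ∷ w) zero    refl = refl
take-suc-At (y ∷ w) (suc i) p    = cong (y ∷_) (take-suc-At w i p)

take-++-≤ : ∀ (u : Word) {z t} → t ≤ length u → take t (u ++ z) ≡ take t u
take-++-≤ u       {t = zero}  _       = refl
take-++-≤ (x ∷ u) {t = suc t} (s≤s p) = cong (x ∷_) (take-++-≤ u p)

take-++-+ : ∀ (u : Word) {z} t → take (length u + t) (u ++ z) ≡ u ++ take t z
take-++-+ []      t = refl
take-++-+ (x ∷ u) t = cong (x ∷_) (take-++-+ u t)

count-++ : ∀ y u v → count y (u ++ v) ≡ count y u + count y v
count-++ y [] v = refl
count-++ A (A ∷ u) v = cong suc (count-++ A u v)
count-++ A (B ∷ u) v = count-++ A u v
count-++ A (C ∷ u) v = count-++ A u v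
count-++ B (A ∷ u) v = count-++ B u v
count-++ B (B ∷ u) v = cong suc (count-++ B u v)
count-++ B (C ∷ u) v = count-++ B u v
count-++ C (A ∷ u) v = count-++ C u v
count-++ C (B ∷ u) v = count-++ C u v
count-++ C (C ∷ u) v = cong suc (count-++ C u v)

count-A-letter : ∀ c w → count A (letter c ∷ w) ≡ count A w
count-A-letter true  w = refl
count-A-letter false w = refl

count-letter-A : ∀ c w → count (letter c) (A ∷ w) ≡ count (letter c) w
count-letter-A true  w = refl
count-letter-A false w = refl

count-letter-own : ∀ c w → count (letter c) (letter c ∷ w) ≡ suc (count (letter c) w)
count-letter-own true  w = refl
count-letter-own false w = refl

count-letter-not : ∀ c w → count (letter (not c)) (letter c ∷ w) ≡ count (letter (not c)) w
count-letter-not true  w = refl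
count-letter-not false w = refl

length-count : ∀ w → length w ≡ count A w + (count B w + count C w)
length-count [] = refl
length-count (A ∷ w) = cong suc (length-count w)
length-count (B ∷ w) = trans (cong suc (length-count w)) (sym (+-suc (count A w) _))
length-count (C ∷ w) = trans (cong suc (length-count w))
  (trans (sym (+-suc (count A w) _)) (cong (count A w +_) (sym (+-suc (count B w) _))))

-- On `Dominant` words the truncated subtraction loses nothing.
level : Bool → Word → ℕ → ℕ
level c w t = count A (take t w) ∸ count (letter c) (take t w)

Dominant : Word → Set
Dominant w = ∀ c t → count (letter c) (take t w) ≤ count A (take t w)

count-take-suc : ∀ w i {x} y → At w i x →
                 count y (take (suc i) w) ≡ count y (take i w) + count y (x ∷ [])
count-take-suc w i y p = trans (cong (count y) (take-suc-At w i p)) (count-++ y (take i w) _)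

module _ {w : Word} (dom : Dominant w) where

  level-A : ∀ c {i} → At w i A → level c w (suc i) ≡ suc (level c w i)
  level-A c {i} p
    rewrite count-take-suc w i A p | count-take-suc w i (letter c) p | count-letter-A c []
          | +-identityʳ (count (letter c) (take i w)) | +-comm (count A (take i w)) 1
    = +-∸-assoc 1 (dom c i)

  level-own : ∀ c {i} → At w i (letter c) → level c w i ≡ suc (level c w (suc i))
  level-own c {i} p with dom c (suc i)
  ... | le rewrite count-take-suc w i A p | count-take-suc w i (letter c) p | count-A-letter c []
          | count-letter-own c [] | +-identityʳ (count A (take i w))
          | +-comm (count (letter c) (take i w)) 1
    = +-∸-assoc 1 le

  level-not : ∀ c {i} → At w i (letter c) → level (not c) w (suc i) ≡ level (not c) w i
  level-not c {i} p
    rewrite count-take-suc w i A p | count-take-suc w i (letter (not c)) p | count-A-letter c []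
          | count-letter-not c [] | +-identityʳ (count A (take i w))
          | +-identityʳ (count (letter (not c)) (take i w))
    = refl

-- One promotion acting on tied positions of a word

record Sliding (M : ℕ) (w w′ : Word) : Set where
  field
    p       : ℕ
    x       : Bool
    p<M     : p < M
    first   : At w 0 A
    special : At w (suc p) (letter x)
    new     : At w′ p A
    last    : At w′ M (letter x)
    keep    : ∀ {t} → t ≢ p → t < M → head (drop t w′) ≡ head (drop (suc t) w)
    slide   : Slide 1 0 p M (level x w ∘ suc) (level (not x) w ∘ suc) (level x w′) (level (not x) w′)
    end     : ∀ c → level c w (suc M) ≡ 0
    hit     : level x w (2 + p) ≡ 0
    touch   : level x w′ p ≡ 0
    flat    : level (not x) w (2 + p) ≡ level (not x) w (suc p)

flip : ∀ {a b p M h k h′ k′} → Slide a b p M h k h′ k′ → Slide b a p M k h k′ h′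
flip S = record
  { before-h = before-k ; before-k = before-h ; after-h = after-k ; after-k = after-h
  ; end-h = end-k ; end-k = end-h }
  where open Slide S

record Forwards (c : Bool) (w : Word) (i j : ℕ) : Set where
  field
    i<j     : i < j
    at-i    : At w i (letter c)
    at-j    : At w j (letter (not c))
    forward : Forward (level c w) (level (not c) w) i j

record Backwards (c : Bool) (w : Word) (i j : ℕ) : Set where
  field
    j<i      : j < i
    at-i     : At w i (letter c)
    at-j     : At w j A
    backward : Backward (length w) (level c w) (level (not c) w) i j

record Opens (c : Bool) (w : Word) (i j : ℕ) : Set where
  field
    i<j     : i < j
    at-i    : At w i A
    at-j    : At w j (letter (not c))
    opening : Opening (level c w) (level (not c) w) i j

module Promotion {M : ℕ} {w w′ : Word} (len : length w ≡ suc M) (len′ : length w′ ≡ suc M)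
                 (dom : Dominant w) (S : Sliding M w w′) where
  open Sliding S

  -- `Sliding` lists the level of w_ι first. Here the data are put with the level of a chosen `c`
  -- first, as `SlideOwn` and `SlideOther` expect them.
  Own Other : Bool → Set
  Own c = c ≡ x × level c w (2 + p) ≡ 0 × level c w′ p ≡ 0 ×
    Slide 1 0 p M (level c w ∘ suc) (level (not c) w ∘ suc) (level c w′) (level (not c) w′)
  Other c = c ≡ not x × level (not c) w (2 + p) ≡ 0 × level (not c) w′ p ≡ 0 ×
    level c w (2 + p) ≡ level c w (suc p) ×
    Slide 0 1 p M (level c w ∘ suc) (level (not c) w ∘ suc) (level c w′) (level (not c) w′)

  view : ∀ c → Own c ⊎ Other c
  view c with x in eq | slide | hit | touch | flat
  view true  | true  | s | h | t | f = inj₁ (refl , h , t , s)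
  view false | false | s | h | t | f = inj₁ (refl , h , t , s)
  view true  | false | s | h | t | f = inj₂ (refl , h , t , f , flip s)
  view false | true  | s | h | t | f = inj₂ (refl , h , t , f , flip s)

  p≢ : ∀ {i y} → At w (suc i) y → y ≢ letter x → p ≢ i
  p≢ at y≢x refl = y≢x (At-unique w (suc p) at special)

  At-<M : ∀ {i y} → At w (suc i) y → i < M
  At-<M {i} at = s≤s⁻¹ (subst (suc i <_) len (At-< w (suc i) at))

  keep-At : ∀ {i y} → p ≢ i → At w (suc i) y → At w′ i y
  keep-At p≢i at = trans (keep (p≢i ∘ sym) (At-<M at)) at

  level-start : ∀ c → level c w 1 ≡ 1
  level-start c = level-A dom c {0} first

  opens-step : ∀ {c i j} → Opens c w (suc i) (suc j) → Opens c w′ i j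
  opens-step {c} {i} {j} O with view c
  ... | inj₁ (refl , _ , touch , s) = record
          { i<j = i<j ; at-i = keep-At p≢i at-i ; at-j = keep-At (p≢ at-j (letter-not c)) at-j
          ; opening = Uniform.opening-step s i<j (<⇒≤ (At-<M at-j)) p≢i apart (opening-tail opening) }
    where
    open Opens O using (at-i; at-j; opening)
    i<j = s≤s⁻¹ (Opens.i<j O)
    p≢i = p≢ at-i (letter≢A c ∘ sym)
    -- An `A` in front of w_ι raises the level behind it to at least 2, but w_ι is met at level 1,
    -- so `above-h` would fail there.
    apart : i < p → p ≤ j → ⊥
    apart i<p p≤j = contradiction
      (subst₂ _≤_ (trans (level-A dom c at-i) (cong suc (Slide.before-h s (<⇒≤ i<p))))
                  (trans (Slide.before-h s ≤-refl) (cong suc touch))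
                  (Opening.above-h opening (s≤s i<p) (s≤s p≤j))) λ { (s≤s ()) }
  ... | inj₂ (refl , _ , touch , _ , s) = record
          { i<j = i<j ; at-i = keep-At p≢i at-i ; at-j = keep-At p≢j at-j
          ; opening = Uniform.opening-step s i<j (<⇒≤ (At-<M at-j)) p≢i apart (opening-tail opening) }
    where
    open Opens O using (at-i; at-j; opening)
    i<j = s≤s⁻¹ (Opens.i<j O)
    p≢i = p≢ at-i (letter≢A x ∘ sym)
    apart : i < p → p ≤ j → ⊥
    apart i<p p≤j = contradiction
      (subst₂ _≤_ (trans (level-A dom (not c) at-i) (cong suc (Slide.before-k s (<⇒≤ i<p))))
                  (trans (Slide.before-k s ≤-refl) (cong suc touch))
                  (Opening.above-k opening (s≤s i<p) (s≤s p≤j))) λ { (s≤s ()) }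
    p≢j : p ≢ j
    p≢j refl = apart i<j ≤-refl

  -- The tie changes its kind in one event only: when the letter at `i` is w_ι itself and is
  -- replaced by an `A`.
  forwards-step : ∀ {c i j} → Forwards c w (suc i) (suc j) → Forwards c w′ i j ⊎ Opens c w′ i j
  forwards-step {c} {i} {j} F with view c
  ... | inj₁ (refl , hit , touch , s)
        with SlideOwn.forward-own s hit touch i<j (<⇒≤ (At-<M at-j)) p≢j
               (level-own dom c at-i) (level-not dom c at-i) (forward-tail forward)
    where
    open Forwards F using (at-i; at-j; forward)
    i<j = s≤s⁻¹ (Forwards.i<j F)
    p≢j = p≢ at-j (letter-not c)
  ...   | inj₁ (p≢i , fwd) = inj₁ record
          { i<j = s≤s⁻¹ (Forwards.i<j F) ; at-i = keep-At p≢i (Forwards.at-i F)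
          ; at-j = keep-At (p≢ (Forwards.at-j F) (letter-not c)) (Forwards.at-j F) ; forward = fwd }
  ...   | inj₂ (refl , opn) = inj₂ record
          { i<j = s≤s⁻¹ (Forwards.i<j F) ; at-i = new
          ; at-j = keep-At (p≢ (Forwards.at-j F) (letter-not c)) (Forwards.at-j F) ; opening = opn }
  forwards-step {c} {i} {j} F | inj₂ (refl , hit , touch , flat , s) = inj₁ record
          { i<j = i<j ; at-i = keep-At p≢i at-i ; at-j = keep-At (proj₁ step) at-j
          ; forward = proj₂ step }
    where
    open Forwards F using (at-i; at-j; forward)
    i<j = s≤s⁻¹ (Forwards.i<j F)
    p≢i = p≢ at-i (letter-not x)
    step = SlideOther.forward-other s hit touch flat i<j (<⇒≤ (At-<M at-j)) p≢i
             (level-own dom c at-i) (level-not dom c at-i)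
             -- The other letter still stands at `j` and lowers its own level there, so that level
             -- is positive.
             (subst (0 <_) (sym (level-own dom (not c) {suc j} at-j)) (s≤s z≤n))
             (level-start c) (forward-tail forward)

  backwards-step : ∀ {c i j} → Backwards c w (suc i) (suc j) → Backwards c w′ i j
  backwards-step {c} {i} {j} T = record
    { j<i = j<i ; at-i = keep-At (p≢i (view c)) at-i ; at-j = keep-At p≢j at-j
    ; backward = subst (λ N → Backward N (level c w′) (level (not c) w′) i j) (sym len′) (step (view c)) }
    where
    open Backwards T using (at-i; at-j; backward)
    j<i = s≤s⁻¹ (Backwards.j<i T)
    p≢j = p≢ at-j (letter≢A x ∘ sym)
    tail : Backward M (level c w ∘ suc) (level (not c) w ∘ suc) i j
    tail = backward-tail 
      (subst (λ N → Backward N (level c w) (level (not c) w) (suc i) (suc j)) len backward)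
    p≢i : Own c ⊎ Other c → p ≢ i
    p≢i (inj₂ (refl , _)) = p≢ at-i (letter-not x)
    p≢i (inj₁ (refl , hit , touch , s)) refl =
      SlideOwn.backward-special s hit touch j<i tail
    step : Own c ⊎ Other c → Backward (suc M) (level c w′) (level (not c) w′) i j
    step (inj₁ (_ , hit , touch , s)) = SlideOwn.backward-own s hit touch j<i (At-<M at-i) p<M p≢j tail
    step v@(inj₂ (_ , hit , touch , flat , s)) =
      SlideOther.backward-other s hit touch flat j<i (At-<M at-i) p<M (p≢i v) p≢j
        (level-own dom c at-i) (level-not dom c at-i) (level-A dom c at-j) tail

  backwards-new : Backwards x w′ M p
  backwards-new with view x
  ... | inj₂ (x≡not-x , _) = contradiction (cong letter (sym x≡not-x)) (letter-not x)
  ... | inj₁ (_ , hit , touch , s) = record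
          { j<i = p<M ; at-i = last ; at-j = new
          ; backward = subst (λ N → Backward N (level x w′) (level (not x) w′) M p) (sym len′)
              (SlideOwn.backward-new s hit touch p<M (end x) (end (not x))) }

  backwards-turn : ∀ {c i} → Backwards c w (suc i) 0 → Forwards c w′ i M
  backwards-turn {c} {i} T = turn (view c)
    where
    open Backwards T using (at-i; backward)
    open Backward (subst (λ N → Backward N (level c w) (level (not c) w) (suc i) 0) len backward)
    h = level c w ∘ suc
    k = level (not c) w ∘ suc
    -- This is `floor` at `t = 0`, where both levels are 0.
    kᵢ<hᵢ : k i < h i
    kᵢ<hᵢ = subst (k i <_) (+-identityʳ (h i)) (floor z≤n z≤n)
    left-tail : ∀ {t} → t ≤ i → Within t i λ s → h i + k s ≤ h t + k i
    left-tail t≤i = pred-within (left (s≤s z≤n) (s≤s t≤i))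
    right-tail : ∀ {t} → i < t → t ≤ M →
                 Within (suc i) t λ s → h s ≤ 0 ⊎ h s + k (suc i) ≤ h (suc i) + k t
    right-tail i<t t≤M = pred-within (right (s≤s i<t) (s≤s t≤M))
    turn : Own c ⊎ Other c → Forwards c w′ i M
    turn (inj₁ (_ , hit , touch , s)) =
      ⊥-elim (SlideOwn.turn-own s hit touch (level-start c) kᵢ<hᵢ left-tail)
    turn (inj₂ (refl , hit , touch , flat , s)) = record
      { i<j = At-<M at-i ; at-i = keep-At (p≢ at-i (letter-not x)) at-i
      ; at-j = subst (At w′ M ∘ letter) (sym (not-involutive x)) last
      ; forward = SlideOther.turn-other s hit touch flat (At-<M at-i)
          (level-own dom c at-i) (level-not dom c at-i) (level-start c) (end (not c))
          kᵢ<hᵢ left-tail right-tail }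

-- Comparing a word with its promotion

record Balanced (n M : ℕ) (w : Word) : Set where
  field
    len      : length w ≡ suc M
    totalA   : count A w ≡ n
    total    : ∀ c → count (letter c) w ≡ n
    dominant : Dominant w

  level-end : ∀ c {t} → length w ≤ t → level c w t ≡ 0
  level-end c {t} le rewrite take-all t w le | totalA | total c = n∸n≡0 n

module Split (u : Word) (x : Bool) (v : Word) where

  before after : Word
  before = A ∷ u ++ letter x ∷ v
  after  = u ++ A ∷ v ++ letter x ∷ []

  length-after : length after ≡ length before
  length-after = trans (length-++ u) (trans (cong (λ m → length u + suc m) (length-++ v))
    (trans (cong (λ m → length u + suc m) (+-comm (length v) 1))
    (trans (+-suc (length u) _) (cong suc (sym (length-++ u))))))

  count-after : ∀ y → count y after ≡ count y before
  count-after y = begin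
    count y after                                    ≡⟨ count-++ y u _ ⟩
    cu + count y (A ∷ v ++ letter x ∷ [])            ≡⟨ cong (cu +_) (count-++ y (A ∷ []) _) ⟩
    cu + (ca + count y (v ++ letter x ∷ []))         ≡⟨ cong (λ m → cu + (ca + m)) (count-++ y v _) ⟩
    cu + (ca + (cv + cx))                            ≡⟨ x∙yz≈y∙xz cu ca (cv + cx) ⟩
    ca + (cu + (cv + cx))                            ≡⟨ cong (λ m → ca + (cu + m)) (+-comm cv cx) ⟩
    ca + (cu + (cx + cv))                            ≡⟨ cong (λ m → ca + (cu + m)) (count-++ y (letter x ∷ []) v) ⟨
    ca + (cu + count y (letter x ∷ v))               ≡⟨ cong (ca +_) (count-++ y u _) ⟨
    ca + count y (u ++ letter x ∷ v)                 ≡⟨ count-++ y (A ∷ []) _ ⟨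
    count y before                                   ∎
    where
    open ≡-Reasoning
    cu = count y u
    ca = count y (A ∷ [])
    cv = count y v
    cx = count y (letter x ∷ [])

  head-drop-after : ∀ {t} → t ≢ length u → t < length (u ++ letter x ∷ v) →
                    head (drop t after) ≡ head (drop (suc t) before)
  head-drop-after = go u
    where
    init : ∀ z {t y} → t < length z → head (drop t (z ++ y)) ≡ head (drop t z)
    init (_ ∷ z) {zero}  _       = refl
    init (_ ∷ z) {suc t} (s≤s p) = init z p
    go : ∀ u {t} → t ≢ length u → t < length (u ++ letter x ∷ v) →
         head (drop t (u ++ A ∷ v ++ letter x ∷ [])) ≡ head (drop t (u ++ letter x ∷ v))
    go []      {zero}  t≢0 _       = contradiction refl t≢0
    go []      {suc t} _   (s≤s p) = init v p
    go (_ ∷ u) {zero}  _   _       = refl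
    go (_ ∷ u) {suc t} t≢  (s≤s p) = go u (t≢ ∘ cong suc) p

  head-drop-++ : ∀ u {y} {z : Word} → head (drop (length u) (u ++ y ∷ z)) ≡ just y
  head-drop-++ []      = refl
  head-drop-++ (_ ∷ u) = head-drop-++ u

  At-last : At after (length (u ++ letter x ∷ v)) (letter x)
  At-last = subst₂ (λ m z → At z m (letter x)) len (++-assoc u (A ∷ v) _)
                   (head-drop-++ (u ++ A ∷ v))
    where
    len : length (u ++ A ∷ v) ≡ length (u ++ letter x ∷ v)
    len = trans (length-++ u) (sym (length-++ u))

  -- A prefix of `after` ends within `u`, or behind the new `A` but before the final letter, or is
  -- the whole word.
  data Position (t : ℕ) : Set where
    early : t ≤ length u → Position t
    late  : ∀ s → length u + suc s ≡ t → s ≤ length v → Position t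
    past  : length before ≤ t → Position t

  position : ∀ t → Position t
  position t with t ≤? length u | length before ≤? t
  ... | yes t≤ | _ = early t≤
  ... | no _ | yes ≤t = past ≤t
  ... | no t≰ | no ≰t with m≤n⇒∃[o]m+o≡n (≰⇒> t≰)
  ...   | s , refl = late s (+-suc (length u) s) (s≤s⁻¹ (+-cancelˡ-< (length u) _ _ (begin-strict
            length u + s               <⟨ s≤s⁻¹ (≰⇒> ≰t) ⟩
            length (u ++ letter x ∷ v) ≡⟨ length-++ u ⟩
            length u + suc (length v)  ∎)))
    where open ≤-Reasoning

  take-after-late : ∀ {s} → s ≤ length v → take (length u + suc s) after ≡ u ++ A ∷ take s v
  take-after-late s≤ = trans (take-++-+ u _) (cong (λ z → u ++ A ∷ z) (take-++-≤ v s≤))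

  module Late (s : ℕ) (s≤ : s ≤ length v) where
    t = length u + suc s

    late-A : count A (take t after) ≡ count A (take (suc t) before)
    late-A rewrite take-++-+ u {letter x ∷ v} (suc s) | take-after-late s≤
      | count-++ A u (A ∷ take s v) | count-++ A u (letter x ∷ take s v)
      | count-A-letter x (take s v) = +-suc (count A u) _

    late-x : suc (count (letter x) (take t after)) ≡ count (letter x) (take (suc t) before)
    late-x rewrite take-++-+ u {letter x ∷ v} (suc s) | take-after-late s≤
      | count-letter-A x (u ++ letter x ∷ take s v)
      | count-++ (letter x) u (A ∷ take s v) | count-++ (letter x) u (letter x ∷ take s v)
      | count-letter-own x (take s v) | count-letter-A x (take s v) = sym (+-suc _ _)

    late-not : count (letter (not x)) (take t after) ≡ count (letter (not x)) (take (suc t) before)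
    late-not rewrite take-++-+ u {letter x ∷ v} (suc s) | take-after-late s≤
      | count-letter-A (not x) (u ++ letter x ∷ take s v)
      | count-++ (letter (not x)) u (A ∷ take s v) | count-++ (letter (not x)) u (letter x ∷ take s v)
      | count-letter-not x (take s v) | count-letter-A (not x) (take s v) = refl

    late-≤ : ∀ c → count (letter c) (take t after) ≤ count (letter c) (take (suc t) before)
    late-≤ c with c Bool.≟ x
    ... | yes refl = <⇒≤ (≤-reflexive late-x)
    ... | no c≢x rewrite ¬-not c≢x = ≤-reflexive late-not

  module _ {n M : ℕ} (bal : Balanced n M before)
           (open-u : ∀ c t → count (letter c) (take t u) ≤ count A (take t u))
           (tight : count (letter x) u ≡ count A u) where
    open Balanced bal

    M≡ : length (u ++ letter x ∷ v) ≡ M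
    M≡ = suc-injective len

    balanced-after : Balanced n M after
    balanced-after = record
      { len = trans length-after len
      ; totalA = trans (count-after A) totalA
      ; total = λ c → trans (count-after (letter c)) (total c)
      ; dominant = λ c t → dom c (position t) }
      where
      dom : ∀ c {t} → Position t → count (letter c) (take t after) ≤ count A (take t after)
      dom c {t} (early t≤) rewrite take-++-≤ u {A ∷ v ++ letter x ∷ []} t≤ = open-u c t
      dom c (late s refl s≤) = begin
        count (letter c) (take t after)        ≤⟨ late-≤ c ⟩
        count (letter c) (take (suc t) before) ≤⟨ dominant c (suc t) ⟩
        count A (take (suc t) before)          ≡⟨ late-A ⟨
        count A (take t after)                 ∎
        where
        open Late s s≤
        open ≤-Reasoning
      dom c {t} (past ≤t) rewrite take-all t after (subst (_≤ t) (sym length-after) ≤t) =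
        ≤-reflexive (trans (trans (count-after (letter c)) (total c))
                           (sym (trans (count-after A) totalA)))

    level-early : ∀ c {t} → t ≤ length u → level c before (suc t) ≡ suc (level c after t)
    level-early c {t} t≤
      rewrite take-++-≤ u {A ∷ v ++ letter x ∷ []} t≤ | take-++-≤ u {letter x ∷ v} t≤
            | count-letter-A c (take t u) = +-∸-assoc 1 (open-u c t)

    late-position : ∀ {t} → length u < t → t ≤ M → ∃[ s ] (length u + suc s ≡ t × s ≤ length v)
    late-position {t} u<t t≤M with position t
    ... | early t≤ = contradiction t≤ (<⇒≱ u<t)
    ... | late s eq s≤ = s , eq , s≤
    ... | past ≤t = contradiction t≤M (<⇒≱ (subst (_≤ t) (cong suc M≡) ≤t))

    level-late-x : ∀ {t} → length u < t → t ≤ M → suc (level x before (suc t)) ≡ level x after t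
    level-late-x u<t t≤M with late-position u<t t≤M
    ... | s , refl , s≤ = begin
        suc (count A (take (suc t) before) ∸ count (letter x) (take (suc t) before))
          ≡⟨ +-∸-assoc 1 (dominant x (suc t)) ⟨
        suc (count A (take (suc t) before)) ∸ count (letter x) (take (suc t) before)
          ≡⟨ cong₂ (λ a b → suc a ∸ b) late-A late-x ⟨
        count A (take t after) ∸ count (letter x) (take t after) ∎
      where
      open Late s s≤
      open ≡-Reasoning

    level-late-not : ∀ {t} → length u < t → t ≤ M → level (not x) before (suc t) ≡ level (not x) after t
    level-late-not u<t t≤M with late-position u<t t≤M
    ... | s , refl , s≤ = sym (cong₂ _∸_ late-A late-not)
      where open Late s s≤

    touch : level x after (length u) ≡ 0
    touch rewrite take-++-≤ u {A ∷ v ++ letter x ∷ []} ≤-refl | take-all (length u) u ≤-refl | tight =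
      n∸n≡0 (count A u)

    special : At before (suc (length u)) (letter x)
    special = head-drop-++ u

    sliding : Sliding M before after
    sliding = record
      { p = length u
      ; x = x
      ; p<M = subst (length u <_) (trans (sym (length-++ u)) M≡) (m<m+n (length u) (s≤s z≤n))
      ; first = refl
      ; special = special
      ; new = head-drop-++ u
      ; last = subst (λ m → At after m (letter x)) M≡ At-last
      ; keep = λ t≢ t<M → head-drop-after t≢ (subst (_ <_) (sym M≡) t<M)
      ; slide = record
          { before-h = level-early x
          ; before-k = level-early (not x)
          ; after-h = level-late-x
          ; after-k = level-late-not
          ; end-h = Balanced.level-end balanced-after x (≤-reflexive (Balanced.len balanced-after))
          ; end-k = Balanced.level-end balanced-after (not x) (≤-reflexive (Balanced.len balanced-after)) }
      ; end = λ c → level-end c (≤-reflexive len)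
      ; hit = suc-injective (trans (sym (level-own dominant x special))
                (trans (level-early x ≤-refl) (cong suc touch)))
      ; touch = touch
      ; flat = level-not dominant x special }

-- Finding the first return to equality

start : ℕ → ℕ → Bool → ℕ
start b c true  = b
start b c false = c

-- The inequalities stop in front of the letter found and are therefore strict; `tight` includes
-- that letter, whence its `suc`.
record Return (a b c : ℕ) (w : Word) : Set where
  field
    {v t}         : Word
    {x}           : Bool
    found         : split a b c w ≡ just (v , letter x , t)
    decomposition : w ≡ v ++ letter x ∷ t
    above-B       : ∀ k → b + count B (take k v) < a + count A (take k v)
    above-C       : ∀ k → c + count C (take k v) < a + count A (take k v)
    tight         : start b c x + suc (count (letter x) v) ≡ a + count A v

≢⇒≡ᵇ-false : ∀ m n → m ≢ n → (m ≡ᵇ n) ≡ false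
≢⇒≡ᵇ-false zero    zero    m≢n = contradiction refl m≢n
≢⇒≡ᵇ-false zero    (suc _) _   = refl
≢⇒≡ᵇ-false (suc _) zero    _   = refl
≢⇒≡ᵇ-false (suc m) (suc n) m≢n = ≢⇒≡ᵇ-false m n (m≢n ∘ cong suc)

≡ᵇ-refl : ∀ n → (n ≡ᵇ n) ≡ true
≡ᵇ-refl zero    = refl
≡ᵇ-refl (suc n) = ≡ᵇ-refl n

-- A strict excess of `A` over `B` now and equality at the end force a return. In the recursion this
-- contradicts an empty remainder.
split-returns : ∀ a b c w → b < a → c < a → b + count B w ≡ a + count A w → Return a b c w
split-returns a b c [] b<a c<a eq =
  contradiction (subst₂ _≡_ (+-identityʳ b) (+-identityʳ a) eq) (<⇒≢ b<a)
split-returns a b c (A ∷ w) b<a c<a eq = record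
  { found = found′
  ; decomposition = cong (A ∷_) decomposition
  ; above-B = λ { zero → +-monoˡ-< 0 b<a
                ; (suc k) → subst (b + count B (take k v) <_) (sym (+-suc a _)) (above-B k) }
  ; above-C = λ { zero → +-monoˡ-< 0 c<a
                ; (suc k) → subst (c + count C (take k v) <_) (sym (+-suc a _)) (above-C k) }
  ; tight = trans (cong (λ m → start b c x + suc m) (count-letter-A x v))
                  (trans tight (sym (+-suc a _))) }
  where
  open Return (split-returns (suc a) b c w (m<n⇒m<1+n b<a) (m<n⇒m<1+n c<a) (trans eq (+-suc a _)))
  found′ : split a b c (A ∷ w) ≡ just (A ∷ v , letter x , t)
  found′ rewrite ≢⇒≡ᵇ-false (suc a) b (>⇒≢ (m<n⇒m<1+n b<a))
               | ≢⇒≡ᵇ-false (suc a) c (>⇒≢ (m<n⇒m<1+n c<a)) | found = refl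
split-returns a b c (B ∷ w) b<a c<a eq with suc b ≟ a
... | yes refl = record
  { x = true ; found = found′ ; decomposition = refl
  ; above-B = λ { zero → +-monoˡ-< 0 b<a ; (suc k) → +-monoˡ-< 0 b<a }
  ; above-C = λ { zero → +-monoˡ-< 0 c<a ; (suc k) → +-monoˡ-< 0 c<a }
  ; tight = +-suc b 0 }
  where
  found′ : split (suc b) b c (B ∷ w) ≡ just ([] , B , w)
  found′ rewrite ≡ᵇ-refl b = refl
... | no 1+b≢a = record
  { found = found′
  ; decomposition = cong (B ∷_) decomposition
  ; above-B = λ { zero → +-monoˡ-< 0 b<a
                ; (suc k) → subst (_< a + count A (take k v)) (sym (+-suc b _)) (above-B k) }
  ; above-C = λ { zero → +-monoˡ-< 0 c<a ; (suc k) → above-C k }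
  ; tight = tight′ x tight }
  where
  open Return (split-returns a (suc b) c w (≤∧≢⇒< b<a 1+b≢a) c<a (trans (sym (+-suc b _)) eq))
  found′ : split a b c (B ∷ w) ≡ just (B ∷ v , letter x , t)
  found′ rewrite ≢⇒≡ᵇ-false a (suc b) (1+b≢a ∘ sym) | ≢⇒≡ᵇ-false a c (>⇒≢ c<a) | found = refl
  tight′ : ∀ x → start (suc b) c x + suc (count (letter x) v) ≡ a + count A v →
           start b c x + suc (count (letter x) (B ∷ v)) ≡ a + count A v
  tight′ true  q = trans (+-suc b _) q
  tight′ false q = q
split-returns a b c (C ∷ w) b<a c<a eq with suc c ≟ a
... | yes refl = record
  { x = false ; found = found′ ; decomposition = refl
  ; above-B = λ { zero → +-monoˡ-< 0 b<a ; (suc k) → +-monoˡ-< 0 b<a }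
  ; above-C = λ { zero → +-monoˡ-< 0 c<a ; (suc k) → +-monoˡ-< 0 c<a }
  ; tight = +-suc c 0 }
  where
  found′ : split (suc c) b c (C ∷ w) ≡ just ([] , C , w)
  found′ rewrite ≢⇒≡ᵇ-false (suc c) b (>⇒≢ b<a) | ≡ᵇ-refl c = refl
... | no 1+c≢a = record
  { found = found′
  ; decomposition = cong (C ∷_) decomposition
  ; above-B = λ { zero → +-monoˡ-< 0 b<a ; (suc k) → above-B k }
  ; above-C = λ { zero → +-monoˡ-< 0 c<a
                ; (suc k) → subst (_< a + count A (take k v)) (sym (+-suc c _)) (above-C k) }
  ; tight = tight′ x tight }
  where
  open Return (split-returns a b (suc c) w b<a (≤∧≢⇒< c<a 1+c≢a) eq)
  found′ : split a b c (C ∷ w) ≡ just (C ∷ v , letter x , t)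
  found′ rewrite ≢⇒≡ᵇ-false a b (>⇒≢ b<a) | ≢⇒≡ᵇ-false a (suc c) (1+c≢a ∘ sym) | found = refl
  tight′ : ∀ x → start b (suc c) x + suc (count (letter x) v) ≡ a + count A v →
           start b c x + suc (count (letter x) (C ∷ v)) ≡ a + count A v
  tight′ true  q = q
  tight′ false q = trans (+-suc c _) q

pro-found : ∀ {y u v x t} → split 1 0 0 u ≡ just (v , x , t) → pro (y ∷ u) ≡ v ++ A ∷ t ++ x ∷ []
pro-found eq rewrite eq = refl

pro-slides : ∀ {n M w} → Balanced n M w → Sliding M w (pro w) × Balanced n M (pro w)
pro-slides {w = []} bal = contradiction (Balanced.len bal) λ ()
pro-slides {w = B ∷ w} bal = contradiction (Balanced.dominant bal true 1) λ ()
pro-slides {w = C ∷ w} bal = contradiction (Balanced.dominant bal false 1) λ ()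
pro-slides {w = A ∷ w} bal
  with split-returns 1 0 0 w (s≤s z≤n) (s≤s z≤n)
         (trans (Balanced.total bal true) (sym (Balanced.totalA bal)))
... | record { v = v ; t = t ; x = x ; found = found ; decomposition = refl
             ; above-B = above-B ; above-C = above-C ; tight = tight }
    = subst (λ w′ → Sliding _ before w′ × Balanced _ _ w′) (sym (pro-found {A} {v ++ letter x ∷ t} found))
            (sliding bal open-u tight′ , balanced-after bal open-u tight′)
  where
  open Split v x t
  -- Strict inequalities with the leading `A` counted become weak ones without it.
  open-u : ∀ c k → count (letter c) (take k v) ≤ count A (take k v)
  open-u true  k = s≤s⁻¹ (above-B k)
  open-u false k = s≤s⁻¹ (above-C k)
  start-0 : ∀ x → start 0 0 x ≡ 0
  start-0 true  = refl
  start-0 false = refl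
  tight′ : count (letter x) v ≡ count A v
  tight′ = suc-injective (subst (λ m → m + suc (count (letter x) v) ≡ suc (count A v)) (start-0 x) tight)

-- Following one letter through a full turn

iter-suc : ∀ k (f : Word → Word) w → iter (suc k) f w ≡ iter k f (f w)
iter-suc zero    f w = refl
iter-suc (suc k) f w = cong f (iter-suc k f w)

iter-+ : ∀ k l (f : Word → Word) w → iter (k + l) f w ≡ iter k f (iter l f w)
iter-+ zero    l f w = refl
iter-+ (suc k) l f w = cong f (iter-+ k l f w)

module _ {n M : ℕ} where

  balanced-pro : ∀ {w} → Balanced n M w → Balanced n M (pro w)
  balanced-pro = proj₂ ∘ pro-slides

  balanced-iter : ∀ k {w} → Balanced n M w → Balanced n M (iter k pro w)
  balanced-iter zero    bal = bal
  balanced-iter (suc k) bal = balanced-pro (balanced-iter k bal)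

  module Pro {w} (bal : Balanced n M w) =
    Promotion (Balanced.len bal) (Balanced.len (balanced-pro bal)) (Balanced.dominant bal)
              (proj₁ (pro-slides bal))

  forwards-iter : ∀ m {c w i j} → Balanced n M w →
                  Forwards c w (m + i) (m + j) ⊎ Opens c w (m + i) (m + j) →
                  Forwards c (iter m pro w) i j ⊎ Opens c (iter m pro w) i j
  forwards-iter zero bal q = q
  forwards-iter (suc m) {c} {w} {i} {j} bal q =
    subst (λ w → Forwards c w i j ⊎ Opens c w i j) (sym (iter-suc m pro w))
          (forwards-iter m (balanced-pro bal) (step q))
    where
    step : Forwards c w (suc m + i) (suc m + j) ⊎ Opens c w (suc m + i) (suc m + j) →
           Forwards c (pro w) (m + i) (m + j) ⊎ Opens c (pro w) (m + i) (m + j)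
    step (inj₁ f) = Pro.forwards-step bal f
    step (inj₂ o) = inj₂ (Pro.opens-step bal o)

  backwards-iter : ∀ q {c w i} → Balanced n M w →
                   Backwards c w (q + i) q → Backwards c (iter q pro w) i 0
  backwards-iter zero bal T = T
  backwards-iter (suc q) {c} {w} {i} bal T =
    subst (λ w → Backwards c w i 0) (sym (iter-suc q pro w))
          (backwards-iter q (balanced-pro bal) (Pro.backwards-step bal T))

  -- A letter moves one place left per promotion until it is w_ι, and it never arrives at the first
  -- place, where an `A` stands. So after some `k` shifts it is w_ι at position `suc q`, leaving an
  -- `A` at `q` and a copy at `M`.
  converted : ∀ j {c w} → Balanced n M w → At w j (letter c) →
              ∃[ k ] ∃[ q ] (j ≡ suc (k + q) × Backwards c (iter (suc k) pro w) M q)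
  converted zero {c} {w} bal at =
    contradiction (At-unique w 0 at (Sliding.first (proj₁ (pro-slides bal)))) (letter≢A c)
  converted (suc j) {c} {w} bal at with j ≟ p
    where open Sliding (proj₁ (pro-slides bal))
  ... | yes refl = 0 , j , refl , subst (λ x → Backwards x (pro w) M j) (x≡c _ _ eq) (Pro.backwards-new bal)
    where
    open Sliding (proj₁ (pro-slides bal))
    eq : letter x ≡ letter c
    eq = At-unique w (suc p) special at
    x≡c : ∀ x c → letter x ≡ letter c → x ≡ c
    x≡c true  true  _ = refl
    x≡c false false _ = refl
  ... | no j≢p with converted j (balanced-pro bal) (Pro.keep-At bal (j≢p ∘ sym) at)
  ...   | k , q , refl , T =
          suc k , q , refl , subst (λ w → Backwards c w M q) (sym (iter-suc (suc k) pro w)) T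

  -- The `suc M` promotions split into `suc k` until the letter becomes an `A`, `q` until that `A`
  -- is first, one that closes it, and `m` with `j + m = M`, which bring the other letter from `M`
  -- to `j`.
  swapped : ∀ {j c w} → Balanced n M w → At w j (letter c) →
            At (iter (suc M) pro w) j (letter (not c))
  swapped {j} {c} {w} bal at with converted j bal at
  ... | k , q , refl , T with m≤n⇒∃[o]m+o≡n (s≤s⁻¹ (subst (j <_) (Balanced.len bal) (At-< w j at)))
  ...   | m , eq = subst (λ w → At w j (letter (not c))) count-steps (at-j end)
    where
    last-letter : suc (k + q) + m ≡ q + suc (m + k)
    last-letter = solve (k ∷ q ∷ m ∷ [])
    steps : m + suc q + suc k ≡ suc (suc (k + q) + m)
    steps = solve (k ∷ q ∷ m ∷ [])
    w₁ w₂ w₃ : Word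
    w₁ = iter (suc k) pro w
    w₂ = iter q pro w₁
    w₃ = pro w₂
    bal₁ = balanced-iter (suc k) bal
    bal₂ = balanced-iter q bal₁
    T₂ : Backwards c w₂ (suc (m + k)) 0
    T₂ = backwards-iter q bal₁ (subst (λ i → Backwards c w₁ i q) (trans (sym eq)
           last-letter) T)
    end : Forwards c (iter m pro w₃) k j ⊎ Opens c (iter m pro w₃) k j
    end = forwards-iter m (balanced-pro bal₂) (inj₁ (subst (Forwards c w₃ (m + k))
            (trans (sym eq) (+-comm j m)) (Pro.backwards-turn bal₂ T₂)))
    at-j : ∀ {w} → Forwards c w k j ⊎ Opens c w k j → At w j (letter (not c))
    at-j (inj₁ f) = Forwards.at-j f
    at-j (inj₂ o) = Opens.at-j o
    count-steps : iter m pro w₃ ≡ iter (suc M) pro w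
    count-steps = begin
      iter m pro (iter (suc q) pro w₁)    ≡⟨ iter-+ m (suc q) pro w₁ ⟨
      iter (m + suc q) pro w₁             ≡⟨ iter-+ (m + suc q) (suc k) pro w ⟨
      iter (m + suc q + suc k) pro w      ≡⟨ cong (λ l → iter l pro w) (trans steps (cong suc eq)) ⟩
      iter (suc M) pro w                  ∎
      where open ≡-Reasoning

-- From single letters to whole words

swap-of-At : ∀ w w′ → length w ≡ length w′ →
             (∀ j c → At w j (letter c) → At w′ j (letter (not c))) →
             count A w′ ≤ count A w × (count A w′ ≡ count A w → w′ ≡ map swapBC w)
swap-of-At [] [] _ _ = z≤n , λ _ → refl
swap-of-At (y ∷ w) (y′ ∷ w′) len swaps
  with swap-of-At w w′ (suc-injective len) (λ j → swaps (suc j))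
swap-of-At (A ∷ w) (A ∷ w′) _ _ | le , eq = s≤s le , cong (A ∷_) ∘ eq ∘ suc-injective
-- An `A` lost here cannot be regained later, since letters other than `A` never turn into one;
-- equal counts exclude it.
swap-of-At (A ∷ w) (B ∷ w′) _ _ | le , eq = m≤n⇒m≤1+n le , λ e → contradiction e (<⇒≢ (s≤s le))
swap-of-At (A ∷ w) (C ∷ w′) _ _ | le , eq = m≤n⇒m≤1+n le , λ e → contradiction e (<⇒≢ (s≤s le))
swap-of-At (B ∷ w) (y′ ∷ w′) _ swaps | le , eq with swaps 0 true refl
... | refl = le , cong (C ∷_) ∘ eq
swap-of-At (C ∷ w) (y′ ∷ w′) _ swaps | le , eq with swaps 0 false refl
... | refl = le , cong (B ∷_) ∘ eq

swapBC-involutive : ∀ w → map swapBC (map swapBC w) ≡ w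
swapBC-involutive [] = refl
swapBC-involutive (A ∷ w) = cong (A ∷_) (swapBC-involutive w)
swapBC-involutive (B ∷ w) = cong (B ∷_) (swapBC-involutive w)
swapBC-involutive (C ∷ w) = cong (C ∷_) (swapBC-involutive w)

iter-swap : ∀ {n M w} → Balanced n M w → iter (suc M) pro w ≡ map swapBC w
iter-swap {n} {M} {w} bal =
  proj₂ (swap-of-At w (iter (suc M) pro w) (trans (len bal) (sym (len bal′))) (λ j c → swapped {j = j} bal))
        (trans (totalA bal′) (sym (totalA bal)))
  where
  open Balanced
  bal′ = balanced-iter (suc M) bal

-- The length is written so that `suc M` computes to `3 * suc n`, and `iter-swap` fits the theorem
-- without rewriting.
balanced : ∀ {n w} → IsKreweras (suc n) w → Balanced (suc n) (n + (2 * suc n)) w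
balanced {n} {w} K = record
  { len = trans (length-count w) (trans (cong₂ _+_ countA (cong₂ _+_ countB countC)) (solve (n ∷ [])))
  ; totalA = countA
  ; total = λ { true → countB ; false → countC }
  ; dominant = λ { true → prefixB ; false → prefixC } }
  where open IsKreweras K

theorem1p2 : ∀ (n : ℕ) (w : Word) → n ≥ 1 → IsKreweras n w →
    (iter (3 * n) pro w ≡ map swapBC w) × (iter (6 * n) pro w ≡ w)
theorem1p2 (suc n) w _ K = half , (begin
    iter (6 * suc n) pro w                             ≡⟨ cong (λ l → iter l pro w) doubled ⟩
    iter (3 * suc n + 3 * suc n) pro w                 ≡⟨ iter-+ (3 * suc n) (3 * suc n) pro w ⟩
    -- The word reached halfway is balanced too, so the first claim applies to it again.
    iter (3 * suc n) pro (iter (3 * suc n) pro w)      ≡⟨ iter-swap (balanced-iter (3 * suc n) bal) ⟩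
    map swapBC (iter (3 * suc n) pro w)                ≡⟨ cong (map swapBC) half ⟩
    map swapBC (map swapBC w)                          ≡⟨ swapBC-involutive w ⟩
    w                                                  ∎)
  where
  open ≡-Reasoning
  bal = balanced K
  doubled : 6 * suc n ≡ 3 * suc n + 3 * suc n
  doubled = solve (n ∷ [])
  half : iter (3 * suc n) pro w ≡ map swapBC w
  half = iter-swap bal
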